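{- We have $$C_{1324,3421}(x)=\left(1+\sum_{k\ge 1}\frac{x^k}{1-x^k}\cdot\prod_{i\ge k+1}\left(1+x^i\right)\right)^2.$$
   Context: $\mathrm{av}_n^k(B)$ is the number of permutations in $S_n$ with exactly $k$ inversions (pairs $i<j$ with $\pi_i>\pi_j$) that avoid every pattern in $B$; a permutation avoids a pattern $q$ if it has no subsequence order-isomorphic to $q$. If for every $k\ge0$ there are constants $m_k,c_k(B)$ with $\mathrm{av}_n^k(B)=c_k(B)$ for all $n\ge m_k$, then $(c_k(B))_{k\ge0}$ is the limit sequence of $B$ and $C_B(x)=\sum_{k\ge 0}c_k(B)x^k$ is its limit generating function (a formal power series); here $B=\{1324,3421\}$. -}

module Defs where

open import Data.Bool.Base using (if_then_else_)
open import Data.Fin as Fin using (Fin; toℕ; #_)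
import Data.Fin.Properties as Finₚ
open import Data.Integer as ℤ using (ℤ; 0ℤ; 1ℤ) renaming (+_ to pos)
import Data.Integer.Properties as ℤₚ
open import Data.List as List using (List; []; _∷_)
open import Data.List.Membership.Propositional using (_∈_; lose)
open import Data.List.Membership.Propositional.Properties
  using (∈-cartesianProductWith⁺; ∈-allFin)
import Data.List.Relation.Unary.All as All
open All using (All)
import Data.List.Relation.Unary.Any as Any
import Data.List.Relation.Unary.Unique.Propositional as List
import Data.List.Relation.Unary.Unique.Propositional.Properties as Uniqueₚ
import Data.List.Relation.Unary.AllPairs as ListAllPairs
open import Data.Nat as ℕ using (ℕ; zero; suc; _≤_; _<_; _∸_; z≤n; s≤s)
import Data.Nat.Properties as ℕₚ
open import Data.Product using (∃-syntax; _×_; _,_)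
open import Data.Vec as Vec using (Vec; []; _∷_; lookup)
import Data.Vec.Properties as Vecₚ
import Data.Vec.Relation.Unary.AllPairs as AllPairs
open import Data.Vec.Relation.Unary.Unique.Propositional using (Unique)
open import Function using (_⇔_; mk⇔; Equivalence)
open import Relation.Binary.PropositionalEquality
open import Relation.Nullary using (Dec; ¬_)
open import Relation.Nullary.Decidable using (map′; _×-dec_; _→-dec_; ¬?)

open import Algebra.Properties.Semiring.Sum ℤₚ.+-*-semiring
  using (sum; sum-cong-≗; sum-replicate-zero; sum-syntax; sum⁺-syntax)

------------------------------------------------------------------------
-- Words

allVecs : ∀ n m → List (Vec (Fin n) m)
allVecs n zero    = [] ∷ []
allVecs n (suc m) =
  List.cartesianProductWith _∷_ (List.allFin n) (allVecs n m)

∈-allVecs : ∀ {n m} (v : Vec (Fin n) m) → v ∈ allVecs n m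
∈-allVecs []      = Any.here refl
∈-allVecs (a ∷ v) = ∈-cartesianProductWith⁺ _∷_ (∈-allFin a) (∈-allVecs v)

allVecs-unique : ∀ n m → List.Unique (allVecs n m)
allVecs-unique n zero    = All.[] ListAllPairs.∷ ListAllPairs.[]
allVecs-unique n (suc m) = Uniqueₚ.cartesianProductWith⁺ _∷_
  Vecₚ.∷-injective (Uniqueₚ.allFin⁺ n) (allVecs-unique n m)

------------------------------------------------------------------------
-- Permutations, in one-line notation with the letters 0, …, n - 1

-- A word of length n over Fin n is a permutation iff its letters are
-- pairwise distinct.
Word : ℕ → Set
Word n = Vec (Fin n) n

IsPermutation : ∀ {n} → Word n → Set
IsPermutation π = Unique π

isPermutation? : ∀ {n} (π : Word n) → Dec (IsPermutation π)
isPermutation? = AllPairs.allPairs? (λ a b → ¬? (a Fin.≟ b))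

IsInversion : ∀ {n} → Word n → Fin n × Fin n → Set
IsInversion π (i , j) = i Fin.< j × lookup π j Fin.< lookup π i

isInversion? : ∀ {n} (π : Word n) ij → Dec (IsInversion π ij)
isInversion? π (i , j) = (i Fin.<? j) ×-dec (lookup π j Fin.<? lookup π i)

inv : ∀ {n} → Word n → ℕ
inv {n} π = List.length (List.filter (isInversion? π)
  (List.cartesianProduct (List.allFin n) (List.allFin n)))

------------------------------------------------------------------------
-- Pattern avoidance

OrderIsomorphic : ∀ {a b m} → Vec (Fin a) m → Vec (Fin b) m → Set
OrderIsomorphic u v = ∀ i j →
  (lookup u i Fin.< lookup u j) ⇔ (lookup v i Fin.< lookup v j)

Increasing : ∀ {n m} → Vec (Fin n) m → Set
Increasing p = ∀ i j → i Fin.< j → lookup p i Fin.< lookup p j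

-- p lists the positions of the subsequence.
IsOccurrence : ∀ {n m} → Word m → Word n → Vec (Fin n) m → Set
IsOccurrence q π p =
  Increasing p × OrderIsomorphic (Vec.map (lookup π) p) q

Contains : ∀ {n m} → Word n → Word m → Set
Contains π q = ∃[ p ] IsOccurrence q π p

Pattern : Set
Pattern = ∃[ m ] Word m

Avoids : ∀ {n} → Word n → Pattern → Set
Avoids π (_ , q) = ¬ Contains π q

isOccurrence? : ∀ {n m} (q : Word m) (π : Word n) p →
                Dec (IsOccurrence q π p)
isOccurrence? q π p =
  Finₚ.all? (λ i → Finₚ.all? λ j →
    (i Fin.<? j) →-dec (lookup p i Fin.<? lookup p j))
  ×-dec
  Finₚ.all? (λ i → Finₚ.all? λ j →
    (lookup s i Fin.<? lookup s j) ⇔-dec (lookup q i Fin.<? lookup q j))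
  where
  s = Vec.map (lookup π) p

  _⇔-dec_ : ∀ {A B : Set} → Dec A → Dec B → Dec (A ⇔ B)
  a? ⇔-dec b? = map′ (λ (f , g) → mk⇔ f g)
                     (λ e → Equivalence.to e , Equivalence.from e)
                     ((a? →-dec b?) ×-dec (b? →-dec a?))

contains? : ∀ {n m} (π : Word n) (q : Word m) → Dec (Contains π q)
contains? {n} {m} π q = map′ Any.satisfied
  (λ (p , occ) → lose (∈-allVecs p) occ)
  (Any.any? (isOccurrence? q π) (allVecs n m))

avoids? : ∀ {n} (π : Word n) q → Dec (Avoids π q)
avoids? π (_ , q) = ¬? (contains? π q)

------------------------------------------------------------------------
-- Counting and limit sequences

Counted : List Pattern → ℕ → ∀ {n} → Word n → Set
Counted B k π = IsPermutation π × inv π ≡ k × All (Avoids π) B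

counted? : ∀ B k {n} (π : Word n) → Dec (Counted B k π)
counted? B k π =
  isPermutation? π ×-dec (inv π ℕ.≟ k) ×-dec All.all? (avoids? π) B

av : (n k : ℕ) → List Pattern → ℕ
av n k B = List.length (List.filter (counted? B k) (allVecs n n))

IsLimitSequence : List Pattern → (ℕ → ℕ) → Set
IsLimitSequence B c = ∀ k → ∃[ m ] ∀ n → m ≤ n → av n k B ≡ c k

limitSequence-unique : ∀ {B c d} → IsLimitSequence B c →
                       IsLimitSequence B d → ∀ k → c k ≡ d k
limitSequence-unique C D k with C k | D k
... | m , p | m′ , p′ =
  trans (sym (p (m ℕ.⊔ m′) (ℕₚ.m≤m⊔n m m′))) (p′ _ (ℕₚ.m≤n⊔m m m′))

p1324 p3421 : Pattern
p1324 = 4 , # 0 ∷ # 2 ∷ # 1 ∷ # 3 ∷ []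
p3421 = 4 , # 2 ∷ # 3 ∷ # 1 ∷ # 0 ∷ []

------------------------------------------------------------------------
-- Formal power series over ℤ, as coefficient sequences

Series : Set
Series = ℕ → ℤ

infix  4 _≈_
infixl 6 _+_ _-_
infixl 7 _*_ _/_
infix  8 _⁻¹ _²
infix  9 x^_

_≈_ : Series → Series → Set
f ≈ g = ∀ n → f n ≡ g n

x^_ : ℕ → Series
(x^ k) n = if n ℕ.≡ᵇ k then 1ℤ else 0ℤ

0# 1# : Series
0# _ = 0ℤ
1# = x^ 0

_+_ _-_ _*_ : Series → Series → Series
(f + g) n = f n ℤ.+ g n
(f - g) n = f n ℤ.- g n
(f * g) n = ∑[ i ≤ n ] (f (toℕ i) ℤ.* g (n ∸ toℕ i))

_² : Series → Series
f ² = f * f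

-- The inverse of a series with constant term 1 (junk otherwise), by
-- solving f * f ⁻¹ ≈ 1# for one coefficient after another.
-- invCoeffs f n lists the coefficients of f ⁻¹ at n - 1, …, 1, 0.
nextCoeff : Series → ∀ n → Vec ℤ n → ℤ
nextCoeff f n v = 1# n ℤ.- ∑[ i < n ] (f (suc (toℕ i)) ℤ.* lookup v i)

invCoeffs : Series → ∀ n → Vec ℤ n
invCoeffs f zero    = []
invCoeffs f (suc n) = nextCoeff f n (invCoeffs f n) ∷ invCoeffs f n

_⁻¹ : Series → Series
(f ⁻¹) n = nextCoeff f n (invCoeffs f n)

_/_ : Series → Series → Series
f / g = f * g ⁻¹

-- Infinite sums and products from index m on. The coefficient of xⁿ is
-- read off the partial sum or product of the first n + 1 terms; this is
-- the coefficientwise limit when the (m + j)-th summand, respectively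
-- the (m + j)-th factor minus 1, is divisible by xʲ (see below).
partialSum partialProduct : (ℕ → Series) → ℕ → Series
partialSum F zero    = 0#
partialSum F (suc N) = F N + partialSum F N
partialProduct F zero    = 1#
partialProduct F (suc N) = F N * partialProduct F N

∑≥ ∏≥ : ℕ → (ℕ → Series) → Series
∑≥ m F n = partialSum     (λ j → F (m ℕ.+ j)) (suc n) n
∏≥ m F n = partialProduct (λ j → F (m ℕ.+ j)) (suc n) n

infixr 5 ∑≥ ∏≥
syntax ∑≥ m (λ k → f) = ∑[ k ≥ m ] f
syntax ∏≥ m (λ k → f) = ∏[ k ≥ m ] f

limitGF : (ℕ → ℕ) → Series
limitGF c k = pos (c k)

------------------------------------------------------------------------
-- Adequacy of inverses, infinite sums and infinite products

VanishesBelow : ℕ → Series → Set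
VanishesBelow k f = ∀ n → n < k → f n ≡ 0ℤ

_⟶_ : (ℕ → Series) → Series → Set
s ⟶ f = ∀ n → ∃[ N ] ∀ M → N ≤ M → s M n ≡ f n

private
  sum-zero : ∀ n {t : Fin n → ℤ} → (∀ i → t i ≡ 0ℤ) → sum t ≡ 0ℤ
  sum-zero n eq = trans (sum-cong-≗ eq) (sum-replicate-zero n)

  lookup-invCoeffs : ∀ f n (i : Fin n) →
    lookup (invCoeffs f n) i ≡ (f ⁻¹) (n ∸ suc (toℕ i))
  lookup-invCoeffs f (suc n) Fin.zero    = refl
  lookup-invCoeffs f (suc n) (Fin.suc i) = lookup-invCoeffs f n i

  stable : ∀ (s : ℕ → Series) → (∀ n N → n < N → s (suc N) n ≡ s N n) →
           s ⟶ (λ n → s (suc n) n)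
  stable s step n = suc n , λ M n<M → go M (ℕₚ.≤⇒≤′ n<M)
    where
    go : ∀ M → suc n ℕ.≤′ M → s M n ≡ s (suc n) n
    go _       ℕ.≤′-refl       = refl
    go (suc M) (ℕ.≤′-step n<M) =
      trans (step n M (ℕₚ.≤′⇒≤ n<M)) (go M n<M)

  1*-below : ∀ f g n → (∀ i → i ≤ n → g i ≡ 1# i) → (g * f) n ≡ f n
  1*-below f g n eq = trans
    (cong₂ ℤ._+_
      (trans (cong (ℤ._* f n) (eq 0 z≤n)) (ℤₚ.*-identityˡ (f n)))
      (sum-zero n λ i →
        cong (ℤ._* f (n ∸ suc (toℕ i))) (eq (suc (toℕ i)) (Finₚ.toℕ<n i))))
    (ℤₚ.+-identityʳ (f n))

  x^-vanishes : ∀ k → VanishesBelow k (x^ k)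
  x^-vanishes (suc k) zero    _         = refl
  x^-vanishes (suc k) (suc n) (s≤s n<k) = x^-vanishes k n n<k

  *-vanishes : ∀ k f g → VanishesBelow k f → VanishesBelow k (f * g)
  *-vanishes k f g van n n<k = sum-zero (suc n) λ i →
    cong (ℤ._* g (n ∸ toℕ i))
      (van (toℕ i) (ℕₚ.≤-<-trans (Finₚ.toℕ≤pred[n] i) n<k))

⁻¹-inverse : ∀ f → f 0 ≡ 1ℤ → f * f ⁻¹ ≈ 1#
⁻¹-inverse f f₀ n = begin
  f 0 ℤ.* (f ⁻¹) n ℤ.+ S′    ≡⟨ cong (ℤ._+ S′) (cong (ℤ._* (f ⁻¹) n) f₀) ⟩
  1ℤ ℤ.* (f ⁻¹) n ℤ.+ S′     ≡⟨ cong (ℤ._+ S′) (ℤₚ.*-identityˡ ((f ⁻¹) n)) ⟩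
  (1# n ℤ.- S) ℤ.+ S′        ≡⟨ cong (λ t → (1# n ℤ.- S) ℤ.+ t) S′≡S ⟩
  (1# n ℤ.- S) ℤ.+ S         ≡⟨ ℤₚ.+-assoc (1# n) (ℤ.- S) S ⟩
  1# n ℤ.+ (ℤ.- S ℤ.+ S)     ≡⟨ cong (λ t → 1# n ℤ.+ t) (ℤₚ.+-inverseˡ S) ⟩
  1# n ℤ.+ 0ℤ                ≡⟨ ℤₚ.+-identityʳ _ ⟩
  1# n                       ∎
  where
  open ≡-Reasoning
  S S′ : ℤ
  S  = ∑[ i < n ] (f (suc (toℕ i)) ℤ.* lookup (invCoeffs f n) i)
  S′ = ∑[ i < n ] (f (suc (toℕ i)) ℤ.* (f ⁻¹) (n ∸ suc (toℕ i)))

  S′≡S : S′ ≡ S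
  S′≡S = sum-cong-≗ λ i →
    cong (f (suc (toℕ i)) ℤ.*_) (sym (lookup-invCoeffs f n i))

∑≥-converges : ∀ m F → (∀ j → VanishesBelow j (F (m ℕ.+ j))) →
               partialSum (λ j → F (m ℕ.+ j)) ⟶ ∑≥ m F
∑≥-converges m F van = stable S λ n N n<N →
  trans (cong (λ t → t ℤ.+ S N n) (van N n n<N)) (ℤₚ.+-identityˡ (S N n))
  where
  S : ℕ → Series
  S = partialSum (λ j → F (m ℕ.+ j))

∏≥-converges : ∀ m F → (∀ j n → n < j → F (m ℕ.+ j) n ≡ 1# n) →
               partialProduct (λ j → F (m ℕ.+ j)) ⟶ ∏≥ m F
∏≥-converges m F one = stable P λ n N n<N →
  1*-below (P N) (F (m ℕ.+ N)) n
    (λ i i≤n → one N i (ℕₚ.≤-<-trans i≤n n<N))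
  where
  P : ℕ → Series
  P = partialProduct (λ j → F (m ℕ.+ j))

1-x^-inverse : ∀ k → (1# - x^ suc k) * (1# - x^ suc k) ⁻¹ ≈ 1#
1-x^-inverse k = ⁻¹-inverse (1# - x^ suc k) refl

∏[1+x^]-converges : ∀ m →
  partialProduct (λ j → 1# + x^ (m ℕ.+ j)) ⟶ (∏[ i ≥ m ] (1# + x^ i))
∏[1+x^]-converges m = ∏≥-converges m (λ i → 1# + x^ i) λ j n n<j →
  trans (cong (λ t → 1# n ℤ.+ t)
          (x^-vanishes (m ℕ.+ j) n (ℕₚ.<-≤-trans n<j (ℕₚ.m≤n+m j m))))
        (ℤₚ.+-identityʳ (1# n))

∑[x^/1-x^]-converges : ∀ (G : ℕ → Series) →
  partialSum (λ j → x^ suc j / (1# - x^ suc j) * G (suc j)) ⟶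
  (∑[ k ≥ 1 ] (x^ k / (1# - x^ k) * G k))
∑[x^/1-x^]-converges G =
  ∑≥-converges 1 (λ k → x^ k / (1# - x^ k) * G k) λ j n n<j →
    *-vanishes (suc j) (x^ suc j / (1# - x^ suc j)) (G (suc j))
      (*-vanishes (suc j) (x^ suc j) ((1# - x^ suc j) ⁻¹)
        (x^-vanishes (suc j)))
      n (ℕₚ.m<n⇒m<1+n n<j)

{-# OPTIONS --safe #-}

-- If π avoids 1324 and has k inversions, and more than k letters lie on either
-- side of a position, then that position is in no inversion: an inversion
-- there could be extended, letter by letter, to too many others. Hence a long
-- π is a direct sum α ⊕ β with both summands long; π avoids {1324, 3421} iff α
-- avoids {132, 3421} and β avoids {213, 3421}, and reverse-complement-inverse
-- exchanges the two conditions while keeping the number of inversions. A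
-- permutation avoids 132 iff its Lehmer code is weakly decreasing, and it then
-- avoids 3421 iff only the smallest nonzero entry of the code is repeated. The
-- two factors of the square therefore count the partitions in which only the
-- smallest part may be repeated.

module Submission where

open import Data.Empty using (⊥; ⊥-elim)
open import Data.Fin as Fin using (Fin; toℕ; _↑ˡ_; _↑ʳ_; punchIn; punchOut; opposite; #_)
import Data.Fin.Properties as Finₚ
open import Data.Integer as ℤ using (ℤ; 0ℤ; 1ℤ) renaming (+_ to pos)
import Data.Integer.Properties as ℤₚ
open import Data.List as List using (List; []; _∷_; _++_)
import Data.List.Properties as Listₚ
open import Data.List.Membership.Propositional using (_∈_)
open import Data.List.Membership.Propositional.Properties
  using (∈-lookup; ∈-filter⁺; ∈-filter⁻; ∈-upTo⁺; ∈-allFin; ∈-cartesianProduct⁺)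
open import Data.List.Relation.Unary.All as All using (All; []; _∷_)
open import Data.List.Relation.Unary.All.Properties using (replicate⁺)
import Data.List.Relation.Unary.AllPairs as AllPairs
import Data.List.Relation.Unary.Any as Any
import Data.List.Relation.Unary.Any.Properties as Anyₚ
import Data.List.Relation.Unary.Unique.Propositional as List
import Data.List.Relation.Unary.Unique.Propositional.Properties as Uniqueₚ
open import Data.Nat as ℕ using (ℕ; zero; suc; _≤_; _<_; _∸_; z≤n; s≤s)
open import Data.Nat.ListAction using () renaming (sum to total)
open import Data.Nat.ListAction.Properties using (sum-++)
import Data.Nat.Properties as ℕₚ
open import Data.Product using (∃-syntax; _×_; _,_; proj₁; proj₂; uncurry)
open import Data.Sum as Sum using (_⊎_; inj₁; inj₂; [_,_]′)
open import Data.Unit using (⊤; tt)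
open import Data.Vec as Vec using (Vec; []; _∷_; lookup)
import Data.Vec.Properties as Vecₚ
import Data.Vec.Relation.Unary.AllPairs as VecAllPairs
import Data.Vec.Relation.Unary.Unique.Propositional.Properties as VecUniqueₚ
open import Function using (_∘_; id; Equivalence)
open import Relation.Binary using (tri<; tri≈; tri>)
open import Relation.Binary.PropositionalEquality
open import Relation.Nullary using (Dec; yes; no; ¬_; contradiction)

open import Algebra.Properties.Semiring.Sum ℤₚ.+-*-semiring
  using (sum; sum-cong-≗)

open import Defs

open Equivalence using (from)

-- Enumerations of finite predicates

-- Why only the smallest part repeats: a Lehmer code entry is the number of smaller letters to the
-- right. Two equal neighbouring entries are an ascent; if a smaller nonzero entry follows them, its
-- letter lies below both and still has a smaller letter to its right, which makes a 3421. Trailing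
-- zeros of the code are dropped, so that it is a partition of the number of inversions in which the
-- length of the word has disappeared; this is why the counts stabilise. A permutation may split as
-- a direct sum in several places; cutting always after `suc k` letters makes the pair of partitions
-- unique. On the side of the series, a series is tied to a weighted set coefficient by coefficient,
-- and two series that count the same set agree. Only the inverse of `1 - x^k`, defined by a
-- recursion without combinatorial meaning, needs an algebraic argument.

record Counts {A : Set} (P : A → Set) (n : ℕ) : Set where
  field
    enum           : Fin n → A
    enum-injective : ∀ {i j} → enum i ≡ enum j → i ≡ j
    sound          : ∀ i → P (enum i)
    index          : ∀ {a} → P a → Fin n
    enum-index     : ∀ {a} (p : P a) → enum (index p) ≡ a

open Counts

private variable
  A B : Set
  P P′ : A → Set
  Q : B → Set
  m n p : ℕ
  s t : ℤ

infixr 5 _⊗_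

_⊗_ : (A → Set) → (B → Set) → A × B → Set
(P ⊗ Q) ab = P (proj₁ ab) × Q (proj₂ ab)

-- Phrased for a relation, since codes, mirror images and direct sums are all relations here.
-- Totality chooses an image, and injectivity of `R` keeps the chosen indices apart.
counts-≤ : Counts P m → Counts Q n → (R : A → B → Set) →
           (∀ {a} → P a → ∃[ b ] Q b × R a b) →
           (∀ {a a′ b} → R a b → R a′ b → a ≡ a′) → m ≤ n
counts-≤ {m = m} {n = n} C D R tot inj = Finₚ.injective⇒≤ {f = f} f-injective
  where
  image : ∀ i → _
  image i = tot (sound C i)

  f : Fin m → Fin n
  f i = index D (proj₁ (proj₂ (image i)))

  enum-f : ∀ i → enum D (f i) ≡ proj₁ (image i)
  enum-f i = enum-index D (proj₁ (proj₂ (image i)))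

  f-injective : ∀ {i j} → f i ≡ f j → i ≡ j
  f-injective {i} {j} eq = enum-injective C (inj
    (proj₂ (proj₂ (image i)))
    (subst (R (enum C j))
      (trans (sym (enum-f j)) (trans (cong (enum D) (sym eq)) (enum-f i)))
      (proj₂ (proj₂ (image j)))))

counts-≡ : Counts P m → Counts Q n → (R : A → B → Set) →
           (∀ {a} → P a → ∃[ b ] Q b × R a b) →
           (∀ {b} → Q b → ∃[ a ] P a × R a b) →
           (∀ {a a′ b} → R a b → R a′ b → a ≡ a′) →
           (∀ {a b b′} → R a b → R a b′ → b ≡ b′) → m ≡ n
counts-≡ C D R tot tot′ inj inj′ = ℕₚ.≤-antisym
  (counts-≤ C D R tot inj) (counts-≤ D C (λ b a → R a b) tot′ inj′)

counts-map : (f : A → B) → (∀ {a} → P a → Q (f a)) →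
             (∀ {a a′} → P a → P a′ → f a ≡ f a′ → a ≡ a′) →
             (∀ {b} → Q b → ∃[ a ] P a × f a ≡ b) →
             Counts P n → Counts Q n
counts-map f P⇒Q inj surj C = record
  { enum           = f ∘ enum C
  ; enum-injective = λ {i} {j} eq →
      enum-injective C (inj (sound C i) (sound C j) eq)
  ; sound          = P⇒Q ∘ sound C
  ; index          = λ q → index C (proj₁ (proj₂ (surj q)))
  ; enum-index     = λ q → trans
      (cong f (enum-index C (proj₁ (proj₂ (surj q))))) (proj₂ (proj₂ (surj q)))
  }

counts-empty : (∀ {a} → ¬ P a) → Counts P 0
counts-empty ¬P = record
  { enum           = λ ()
  ; enum-injective = λ { {()} }
  ; sound          = λ ()
  ; index          = λ p → ⊥-elim (¬P p)
  ; enum-index     = λ p → ⊥-elim (¬P p)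
  }

counts-singleton : ∀ a → P a → (∀ {b} → P b → b ≡ a) → Counts P 1
counts-singleton a p unique = record
  { enum           = λ _ → a
  ; enum-injective = λ { {Fin.zero} {Fin.zero} _ → refl }
  ; sound          = λ _ → p
  ; index          = λ _ → Fin.zero
  ; enum-index     = λ q → sym (unique q)
  }

counts-Fin : ∀ n → Counts {Fin n} (λ _ → ⊤) n
counts-Fin n = record
  { enum           = id
  ; enum-injective = id
  ; sound          = λ _ → tt
  ; index          = λ {i} _ → i
  ; enum-index     = λ _ → refl
  }

counts-⊎ : Counts P m → Counts Q n →
           Counts {A ⊎ B} [ P , Q ]′ (m ℕ.+ n)
counts-⊎ {P = P} {m = m} {Q = Q} {n = n} C D = record
  { enum           = Sum.map (enum C) (enum D) ∘ Fin.splitAt m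
  ; enum-injective = λ {i} {j} eq → trans (sym (Finₚ.join-splitAt m n i))
      (trans (cong (Fin.join m n) (inj (Fin.splitAt m i) (Fin.splitAt m j) eq)) (Finₚ.join-splitAt m n j))
  ; sound          = λ i → snd (Fin.splitAt m i)
  ; index          = λ {x} → idx x
  ; enum-index     = λ {x} → enum-idx x
  }
  where
  inj : ∀ x y → Sum.map (enum C) (enum D) x ≡ Sum.map (enum C) (enum D) y →
        x ≡ y
  inj (inj₁ x) (inj₁ y) eq = cong inj₁ (enum-injective C (inj₁-inj eq))
    where
    inj₁-inj : ∀ {a b} → inj₁ a ≡ inj₁ b → a ≡ b
    inj₁-inj refl = refl
  inj (inj₂ x) (inj₂ y) eq = cong inj₂ (enum-injective D (inj₂-inj eq))
    where
    inj₂-inj : ∀ {a b} → inj₂ a ≡ inj₂ b → a ≡ b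
    inj₂-inj refl = refl

  snd : ∀ x → [ P , Q ]′ (Sum.map (enum C) (enum D) x)
  snd (inj₁ i) = sound C i
  snd (inj₂ j) = sound D j

  idx : ∀ x → [ P , Q ]′ x → Fin (m ℕ.+ n)
  idx (inj₁ _) p = index C p ↑ˡ n
  idx (inj₂ _) q = m ↑ʳ index D q

  enum-idx : ∀ x p → Sum.map (enum C) (enum D) (Fin.splitAt m (idx x p)) ≡ x
  enum-idx (inj₁ _) p rewrite Finₚ.splitAt-↑ˡ m (index C p) n =
    cong inj₁ (enum-index C p)
  enum-idx (inj₂ _) q rewrite Finₚ.splitAt-↑ʳ m n (index D q) =
    cong inj₂ (enum-index D q)

counts-∪ : (∀ {a} → P a → P′ a → ⊥) → Counts P m → Counts P′ n →
           Counts (λ a → P a ⊎ P′ a) (m ℕ.+ n)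
counts-∪ {P = P} {P′ = P′} disjoint C D = counts-map [ id , id ]′
  (λ { {inj₁ _} → inj₁ ; {inj₂ _} → inj₂ })
  (λ { {inj₁ _} {inj₁ _} _ _ refl → refl
     ; {inj₁ _} {inj₂ _} p q refl → ⊥-elim (disjoint p q)
     ; {inj₂ _} {inj₁ _} q p refl → ⊥-elim (disjoint p q)
     ; {inj₂ _} {inj₂ _} _ _ refl → refl })
  (λ { (inj₁ p) → inj₁ _ , p , refl ; (inj₂ q) → inj₂ _ , q , refl })
  (counts-⊎ C D)

counts-× : Counts P m → Counts Q n →
           Counts (P ⊗ Q) (m ℕ.* n)
counts-× {m = m} {n = n} C D = record
  { enum           = λ i → let (j , k) = Fin.remQuot n i in enum C j , enum D k
  ; enum-injective = λ {i} {j} eq → trans (sym (Finₚ.combine-remQuot {m} n i))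
      (trans (cong₂ Fin.combine
               (enum-injective C (cong proj₁ eq))
               (enum-injective D (cong proj₂ eq)))
             (Finₚ.combine-remQuot {m} n j))
  ; sound          = λ i → sound C _ , sound D _
  ; index          = λ (p , q) → Fin.combine (index C p) (index D q)
  ; enum-index     = λ (p , q) →
      trans (cong (λ (j , k) → enum C j , enum D k)
              (Finₚ.remQuot-combine (index C p) (index D q)))
            (cong₂ _,_ (enum-index C p) (enum-index D q))
  }

lookup-injective : ∀ {xs : List A} → List.Unique xs → ∀ i j →
                   List.lookup xs i ≡ List.lookup xs j → i ≡ j
lookup-injective (_ AllPairs.∷ _) Fin.zero Fin.zero _ = refl
lookup-injective (x∉ AllPairs.∷ _) Fin.zero (Fin.suc j) eq =
  contradiction eq (All.lookup x∉ (∈-lookup j))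
lookup-injective (x∉ AllPairs.∷ _) (Fin.suc i) Fin.zero eq =
  contradiction (sym eq) (All.lookup x∉ (∈-lookup i))
lookup-injective (_ AllPairs.∷ u) (Fin.suc i) (Fin.suc j) eq =
  cong Fin.suc (lookup-injective u i j eq)

counts-filter : (P? : ∀ a → Dec (P a)) → ∀ {xs} → List.Unique xs →
                (∀ {a} → P a → a ∈ xs) →
                Counts P (List.length (List.filter P? xs))
counts-filter {P = P} P? {xs} unique complete = record
  { enum           = List.lookup ys
  ; enum-injective = lookup-injective (Uniqueₚ.filter⁺ P? unique) _ _
  ; sound          = λ i → proj₂ (∈-filter⁻ P? {xs = xs} (∈-lookup i))
  ; index          = λ p → Any.index (member p)
  ; enum-index     = λ p → sym (Anyₚ.lookup-index (member p))
  }
  where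
  ys = List.filter P? xs

  member : ∀ {a} → P a → a ∈ ys
  member p = ∈-filter⁺ P? (complete p) p

-- Coefficients as cardinalities

_counts_ : ℤ → {A : Set} → (A → Set) → Set
t counts P = ∃[ n ] Counts P n × t ≡ pos n

-- The source of `gf-det`: two coefficients agree because they count the same set.
counts-det : s counts P → t counts P → s ≡ t
counts-det (_ , C , refl) (_ , D , refl) = cong pos
  (counts-≡ C D _≡_ (λ p → _ , p , refl) (λ p → _ , p , refl)
    (λ { refl refl → refl }) (λ { refl refl → refl }))

map-counts : (f : A → B) → (∀ {a} → P a → Q (f a)) →
             (∀ {a a′} → P a → P a′ → f a ≡ f a′ → a ≡ a′) →
             (∀ {b} → Q b → ∃[ a ] P a × f a ≡ b) →
             t counts P → t counts Q
map-counts f P⇒Q inj surj (n , C , eq) =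
  n , counts-map f P⇒Q inj surj C , eq

equiv-counts : (∀ {a} → P a → P′ a) → (∀ {a} → P′ a → P a) →
               t counts P → t counts P′
equiv-counts P⇒P′ P′⇒P =
  map-counts id P⇒P′ (λ _ _ → id) (λ p → _ , P′⇒P p , refl)

empty-counts : (∀ {a} → ¬ P a) → 0ℤ counts P
empty-counts ¬P = 0 , counts-empty ¬P , refl

∪-counts : (∀ {a} → P a → P′ a → ⊥) → s counts P → t counts P′ →
           (s ℤ.+ t) counts (λ a → P a ⊎ P′ a)
∪-counts disjoint (m , C , refl) (n , D , refl) =
  m ℕ.+ n , counts-∪ disjoint C D , sym (ℤₚ.pos-+ m n)

×-counts : s counts P → t counts Q →
           (s ℤ.* t) counts (P ⊗ Q)
×-counts (m , C , refl) (n , D , refl) =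
  m ℕ.* n , counts-× C D , sym (ℤₚ.pos-* m n)

sum-counts : ∀ {N} (c : Fin N → ℤ) (P : Fin N → A → Set) →
             (∀ i → c i counts P i) →
             (∀ {i j a} → P i a → P j a → i ≡ j) →
             sum c counts (λ a → ∃[ i ] P i a)
sum-counts {N = zero}  c P C disjoint = empty-counts λ ()
sum-counts {N = suc N} c P C disjoint = equiv-counts
  [ Fin.zero ,_ , (λ (i , p) → Fin.suc i , p) ]′
  (λ { (Fin.zero , p) → inj₁ p ; (Fin.suc i , p) → inj₂ (i , p) })
  (∪-counts (λ { p (i , q) → case (disjoint p q) })
    (C Fin.zero)
    (sum-counts (c ∘ Fin.suc) (P ∘ Fin.suc) (C ∘ Fin.suc)
      λ p q → Finₚ.suc-injective (disjoint p q)))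
  where
  case : ∀ {i : Fin N} → Fin.zero ≡ Fin.suc i → ⊥
  case ()

-- Generating functions

record IsGF (f : Series) {A : Set} (P : A → Set) (ω : A → ℕ) : Set where
  constructor gf
  field
    coefficient : ∀ n → f n counts (λ a → P a × ω a ≡ n)

open IsGF

private variable
  φ ψ : Series
  ω υ : A → ℕ

gf-det : IsGF φ P ω → IsGF ψ P ω → φ ≈ ψ
gf-det (gf F) (gf G) n = counts-det (F n) (G n)

gf-map : (h : A → B) → (∀ {a} → P a → Q (h a)) →
         (∀ {a} → P a → υ (h a) ≡ ω a) →
         (∀ {a a′} → P a → P a′ → h a ≡ h a′ → a ≡ a′) →
         (∀ {b} → Q b → ∃[ a ] P a × h a ≡ b) →
         IsGF φ P ω → IsGF φ Q υ
gf-map {υ = υ} h P⇒Q weight inj surj (gf F) = gf λ n → map-counts h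
  (λ (p , eq) → P⇒Q p , trans (weight p) eq)
  (λ (p , _) (p′ , _) → inj p p′)
  (λ { (q , eq) → let (a , p , eq′) = surj q in
       a , (p , trans (sym (weight p)) (trans (cong υ eq′) eq)) , eq′ })
  (F n)

gf-equiv : (∀ {a} → P a → P′ a) → (∀ {a} → P′ a → P a) →
           IsGF φ P ω → IsGF φ P′ ω
gf-equiv {ω = ω} P⇒P′ P′⇒P =
  gf-map {υ = ω} id P⇒P′ (λ _ → refl) (λ _ _ → id) (λ p → _ , P′⇒P p , refl)

gf-empty : (∀ {a} → ¬ P a) → IsGF 0# P ω
gf-empty ¬P = gf λ n → empty-counts λ (p , _) → ¬P p

x^-≡ : ∀ k → (x^ k) k ≡ 1ℤ
x^-≡ zero    = refl
x^-≡ (suc k) = x^-≡ k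

x^-≢ : ∀ k n → k ≢ n → (x^ k) n ≡ 0ℤ
x^-≢ zero    zero    k≢n = contradiction refl k≢n
x^-≢ zero    (suc n) k≢n = refl
x^-≢ (suc k) zero    k≢n = refl
x^-≢ (suc k) (suc n) k≢n = x^-≢ k n (k≢n ∘ cong suc)

gf-x^ : ∀ (a : A) k → ω a ≡ k → IsGF (x^ k) (_≡ a) ω
gf-x^ {ω = ω} a k eq = gf λ n → coeff n (k ℕₚ.≟ n)
  where
  coeff : ∀ n → Dec (k ≡ n) → (x^ k) n counts (λ b → b ≡ a × ω b ≡ n)
  coeff n (yes refl) = 1 , counts-singleton a (refl , eq) proj₁ , x^-≡ k
  coeff n (no  k≢n)  = 0 ,
    counts-empty (λ { (refl , eq′) → k≢n (trans (sym eq) eq′) }) , x^-≢ k n k≢n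

gf-+ : (∀ {a} → P a → P′ a → ⊥) → IsGF φ P ω → IsGF ψ P′ ω →
       IsGF (φ + ψ) (λ a → P a ⊎ P′ a) ω
gf-+ disjoint (gf F) (gf G) = gf λ n → equiv-counts
  [ (λ (p , eq) → inj₁ p , eq) , (λ (q , eq) → inj₂ q , eq) ]′
  (λ { (inj₁ p , eq) → inj₁ (p , eq) ; (inj₂ q , eq) → inj₂ (q , eq) })
  (∪-counts (λ (p , _) (q , _) → disjoint p q) (F n) (G n))

_⊞_ : (A → ℕ) → (B → ℕ) → A × B → ℕ
(ω ⊞ υ) ab = ω (proj₁ ab) ℕ.+ υ (proj₂ ab)

-- The Cauchy product sorts the pairs of weight `n` by the weight `i` of the first component;
-- weights being natural numbers, `i` is at most `n`.
gf-* : IsGF φ P ω → IsGF ψ Q υ →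
       IsGF (φ * ψ) (P ⊗ Q) (ω ⊞ υ)
gf-* {φ} {P = P} {ω} {ψ} {Q = Q} {υ} (gf F) (gf G) = gf λ n → equiv-counts
  (λ { (i , (p , eq) , (q , eq′)) → (p , q) , trans (cong₂ ℕ._+_ eq eq′)
         (ℕₚ.m+[n∸m]≡n (ℕₚ.≤-pred (Finₚ.toℕ<n i))) })
  (λ { {a , b} ((p , q) , refl) →
    let wa<n = s≤s (ℕₚ.m≤m+n (ω a) (υ b)) ; eq = Finₚ.toℕ-fromℕ< wa<n in
    Fin.fromℕ< wa<n , (p , sym eq) ,
    (q , sym (trans (cong (ω a ℕ.+ υ b ∸_) eq) (ℕₚ.m+n∸m≡n (ω a) (υ b)))) })
  (sum-counts {N = suc n} (λ i → φ (toℕ i) ℤ.* ψ (n ∸ toℕ i))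
    (λ i → (λ a → P a × ω a ≡ toℕ i) ⊗ (λ b → Q b × υ b ≡ n ∸ toℕ i))
    (λ i → ×-counts (F (toℕ i)) (G (n ∸ toℕ i)))
    (λ ((_ , eq) , _) ((_ , eq′) , _) →
      Finₚ.toℕ-injective (trans (sym eq) eq′)))

-- Geometric series

multiples : ℕ → Series
multiples k n =
  pos (List.length (List.filter (λ t → t ℕ.* suc k ℕ.≟ n) (List.upTo (suc n))))

gf-multiples : ∀ k → IsGF (multiples k) (λ (_ : ℕ) → ⊤) (ℕ._* suc k)
gf-multiples k = gf λ n → equiv-counts (tt ,_) proj₂
  (_ , counts-filter (λ t → t ℕ.* suc k ℕ.≟ n) (Uniqueₚ.upTo⁺ (suc n))
         (λ { {t} refl → ∈-upTo⁺ (s≤s (ℕₚ.m≤m*n t (suc k))) }) , refl)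

-- In the coefficient at `n`, the only summand with `g n` itself carries the factor `f 0`.
*-cong-below : ∀ (f g h : Series) → f 0 ≡ 0ℤ → ∀ n →
               (∀ i → i < n → g i ≡ h i) → (f * g) n ≡ (f * h) n
*-cong-below f g h f₀ n eq = sum-cong-≗ {suc n}
  {λ i → f (toℕ i) ℤ.* g (n ∸ toℕ i)} {λ i → f (toℕ i) ℤ.* h (n ∸ toℕ i)} λ
  { Fin.zero    → trans (cong (ℤ._* g n) f₀) (sym (cong (ℤ._* h n) f₀))
  ; (Fin.suc i) → cong (f (suc (toℕ i)) ℤ.*_)
      (eq _ (ℕₚ.∸-monoʳ-< (s≤s z≤n) (Finₚ.toℕ<n i))) }

fixpoint-unique : ∀ (f h g g′ : Series) → f 0 ≡ 0ℤ →
                  g ≈ h + f * g → g′ ≈ h + f * g′ → g ≈ g′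
fixpoint-unique f h g g′ f₀ eq eq′ n = go n n ℕₚ.≤-refl
  where
  -- Strong induction on `n`, made structural by the bound `m`.
  go : ∀ m n → n ≤ m → g n ≡ g′ n
  go m n n≤m = trans (eq n) (trans
    (cong (λ t → h n ℤ.+ t) (*-cong-below f g g′ f₀ n (below m n≤m))) (sym (eq′ n)))
    where
    below : ∀ m → n ≤ m → ∀ i → i < n → g i ≡ g′ i
    below (suc m) n≤m i i<n = go m i (ℕₚ.≤-pred (ℕₚ.≤-trans i<n n≤m))
    below zero    n≤m i i<n = contradiction (ℕₚ.≤-trans i<n n≤m) λ ()

module _ (f : Series) where

  private
    sum-neg : ∀ {N} (c : Fin N → ℤ) → sum (λ i → ℤ.- c i) ≡ ℤ.- sum c
    sum-neg {zero}  c = refl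
    sum-neg {suc N} c = trans (cong (λ t → ℤ.- c Fin.zero ℤ.+ t) (sum-neg (c ∘ Fin.suc)))
      (sym (ℤₚ.neg-distrib-+ (c Fin.zero) (sum (c ∘ Fin.suc))))

  -- This is `(1# - f) * g ≈ 1#` rearranged: as `f 0` vanishes, the first summand of the product at
  -- `n` is `g n` and the others add up to `- T n`.
  geometric : f 0 ≡ 0ℤ → (1# - f) ⁻¹ ≈ 1# + f * (1# - f) ⁻¹
  geometric f₀ n = begin
    g n                         ≡⟨ x≡x-y+y (g n) (T n) ⟩
    (g n ℤ.+ ℤ.- T n) ℤ.+ T n     ≡⟨ cong (λ t → (g n ℤ.+ t) ℤ.+ T n) (sum-neg (c n)) ⟨
    (g n ℤ.+ sum (λ i → ℤ.- c n i)) ℤ.+ T n ≡⟨ cong (ℤ._+ T n) (cong₂ ℤ._+_ head tail) ⟩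
    ((1# - f) * g) n ℤ.+ T n    ≡⟨ cong₂ ℤ._+_ (⁻¹-inverse (1# - f) (cong (λ t → 1ℤ ℤ.- t) f₀) n) (sym T≡) ⟩
    1# n ℤ.+ (f * g) n ∎
    where
    open ≡-Reasoning
    g : Series
    g = (1# - f) ⁻¹

    c : ∀ n → Fin n → ℤ
    c n i = f (suc (toℕ i)) ℤ.* g (n ∸ suc (toℕ i))

    T : ℕ → ℤ
    T n = sum (c n)

    T≡ : (f * g) n ≡ T n
    T≡ = trans (cong (λ t → t ℤ.* g n ℤ.+ T n) f₀) (ℤₚ.+-identityˡ (T n))

    head : g n ≡ (1ℤ ℤ.- f 0) ℤ.* g n
    head = sym (trans (cong (λ t → (1ℤ ℤ.- t) ℤ.* g n) f₀) (ℤₚ.*-identityˡ (g n)))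

    tail : sum (λ i → ℤ.- c n i) ≡
           sum {n} (λ i → (1# - f) (suc (toℕ i)) ℤ.* g (n ∸ suc (toℕ i)))
    tail = sum-cong-≗ {n} {λ i → ℤ.- c n i} λ i → trans
      (ℤₚ.neg-distribˡ-* (f (suc (toℕ i))) (g (n ∸ suc (toℕ i))))
      (cong (ℤ._* g (n ∸ suc (toℕ i))) (sym (ℤₚ.+-identityˡ (ℤ.- f (suc (toℕ i))))))

    x≡x-y+y : ∀ x y → x ≡ (x ℤ.+ ℤ.- y) ℤ.+ y
    x≡x-y+y x y = sym (trans (ℤₚ.+-assoc x (ℤ.- y) y)
      (trans (cong (λ t → x ℤ.+ t) (ℤₚ.+-inverseˡ y)) (ℤₚ.+-identityʳ x)))

-- `multiples k` counts by construction. Since a natural number is zero or a successor, it satisfies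
-- the same fixpoint equation as the inverse, and the solution is unique.
gf-geometric : ∀ k → IsGF ((1# - x^ suc k) ⁻¹) (λ (_ : ℕ) → ⊤) (ℕ._* suc k)
gf-geometric k = gf λ n →
  subst (_counts (λ t → ⊤ × t ℕ.* suc k ≡ n)) (eq n) (coefficient (gf-multiples k) n)
  where
  rec : IsGF (1# + x^ suc k * multiples k) (λ (_ : ℕ) → ⊤) (ℕ._* suc k)
  rec = gf-equiv (λ _ → tt)
    (λ { {zero} _ → inj₁ refl ; {suc t} _ → inj₂ (t , refl) })
    (gf-+ {P = _≡ 0} {P′ = λ t → ∃[ t′ ] t ≡ suc t′} (λ { refl () })
      (gf-x^ 0 0 refl)
      (gf-map (λ (_ , t) → suc t) (λ { {_ , t} _ → t , refl }) (λ _ → refl)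
        (λ { (refl , _) (refl , _) refl → refl })
        (λ { (t , refl) → (tt , t) , (refl , tt) , refl })
        (gf-* (gf-x^ {ω = λ _ → suc k} tt (suc k) refl) (gf-multiples k))))

  eq : multiples k ≈ (1# - x^ suc k) ⁻¹
  eq = fixpoint-unique (x^ suc k) 1# (multiples k) _ refl
    (gf-det (gf-multiples k) rec) (geometric (x^ suc k) refl)

-- Partitions, as weakly decreasing lists

-- The half-open range of parts from `m` to `u` fits partial products: `N` factors starting at `m`
-- correspond to `u = m + N`.
data Distinct (m : ℕ) : ℕ → List ℕ → Set where
  []   : ∀ {u} → Distinct m u []
  cons : ∀ {u p ps} → m ≤ p → p < u → Distinct m p ps → Distinct m u (p ∷ ps)

-- No part exceeds the total, so the truncated product already has the right coefficient in each
-- weight.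
distinct-bound : ∀ {m u u′ ps} → total ps < u′ → Distinct m u ps →
                 Distinct m u′ ps
distinct-bound _  []           = []
distinct-bound {ps = p ∷ ps} <u′ (cons m≤p p<u d) =
  cons m≤p (ℕₚ.≤-<-trans (ℕₚ.m≤m+n p (total ps)) <u′) d

distinct-mono : ∀ {m u u′ ps} → u ≤ u′ → Distinct m u ps → Distinct m u′ ps
distinct-mono _    []             = []
distinct-mono u≤u′ (cons m≤p p<u d) = cons m≤p (ℕₚ.<-≤-trans p<u u≤u′) d

-- The last factor decides whether the largest admissible part, `m + N`, occurs. That part stands in
-- front, so whether it was chosen can be read off the list.
gf-partialProduct : ∀ m N → IsGF
  (partialProduct (λ j → 1# + x^ (m ℕ.+ j)) N) (Distinct m (m ℕ.+ N)) total
gf-partialProduct m zero    = gf-equiv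
  (λ { refl → [] })
  (λ { []              → refl
     ; (cons m≤p p<m _) → contradiction p<m
         (ℕₚ.≤⇒≯ (ℕₚ.≤-trans (ℕₚ.≤-reflexive (ℕₚ.+-identityʳ m)) m≤p)) })
  (gf-x^ [] 0 refl)
gf-partialProduct m (suc N) = gf-map (uncurry _++_)
  (λ { {[] , ps} (inj₁ refl , d) → distinct-mono (ℕₚ.+-monoʳ-≤ m (ℕₚ.n≤1+n N)) d
     ; (inj₂ refl , d) → cons (ℕₚ.m≤m+n m N) last< d })
  (λ { {qs , ps} _ → sum-++ qs ps })
  (λ { (inj₁ refl , _) (inj₁ refl , _) refl → refl
     ; (inj₁ refl , d) (inj₂ refl , _) refl → contradiction d top∉
     ; (inj₂ refl , _) (inj₁ refl , d) refl → contradiction d top∉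
     ; (inj₂ refl , _) (inj₂ refl , _) refl → refl })
  surj
  (gf-* (gf-+ {P = _≡ []} {P′ = _≡ (m ℕ.+ N ∷ [])} (λ { refl () })
          (gf-x^ [] 0 refl)
          (gf-x^ (m ℕ.+ N ∷ []) (m ℕ.+ N) (ℕₚ.+-identityʳ _)))
        (gf-partialProduct m N))
  where
  last< : m ℕ.+ N < m ℕ.+ suc N
  last< = ℕₚ.+-monoʳ-< m (ℕₚ.n<1+n N)

  top∉ : ∀ {ps} → ¬ Distinct m (m ℕ.+ N) (m ℕ.+ N ∷ ps)
  top∉ (cons _ p<p _) = ℕₚ.<-irrefl refl p<p

  surj : ∀ {ps} → Distinct m (m ℕ.+ suc N) ps →
         ∃[ qs ] ((proj₁ qs ≡ [] ⊎ proj₁ qs ≡ (m ℕ.+ N ∷ [])) ×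
                  Distinct m (m ℕ.+ N) (proj₂ qs)) × uncurry _++_ qs ≡ ps
  surj [] = ([] , []) , (inj₁ refl , []) , refl
  surj (cons {p = p} {ps} m≤p p<u d) with p ℕₚ.≟ m ℕ.+ N
  ... | yes refl = (_ ∷ [] , ps) , (inj₂ refl , d) , refl
  ... | no  p≢   = ([] , p ∷ ps) , (inj₁ refl , cons m≤p p<m+N d) , refl
    where
    p<m+N = ℕₚ.≤∧≢⇒< (ℕₚ.≤-pred (subst (p <_) (ℕₚ.+-suc m N) p<u)) p≢

gf-∏ : ∀ m → IsGF (∏[ i ≥ m ] (1# + x^ i)) (λ ps → ∃[ u ] Distinct m u ps) total
gf-∏ m = gf λ n → equiv-counts
  (λ (d , eq) → (_ , d) , eq)
  (λ { ((u , d) , refl) → distinct-bound (ℕₚ.m≤n+m (suc n) m) d , refl })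
  (coefficient (gf-partialProduct m (suc n)) n)

-- The partitions counted by x^k / (1 - x^k) ∏_{i > k} (1 + x^i): only the
-- smallest part, k, may be repeated.
data Tailed (k : ℕ) : List ℕ → Set where
  repeated : ∀ t {ps} → ps ≡ List.replicate t k → Tailed k (k ∷ ps)
  cons     : ∀ {p q ps} → q < p → Tailed k (q ∷ ps) → Tailed k (p ∷ q ∷ ps)

tailed-unique : ∀ {k k′ ps} → Tailed k ps → Tailed k′ ps → k ≡ k′
tailed-unique (repeated _ _) (repeated _ _) = refl
tailed-unique (repeated (suc t) refl) (cons k<k _) = contradiction k<k (ℕₚ.<-irrefl refl)
tailed-unique (cons k<k _) (repeated (suc t) refl) = contradiction k<k (ℕₚ.<-irrefl refl)
tailed-unique (cons _ T) (cons _ T′) = tailed-unique T T′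

tailed-++ : ∀ {k u} ps t → Distinct (suc k) u ps →
            Tailed k (ps ++ List.replicate (suc t) k)
tailed-++ []           t []             = repeated t refl
tailed-++ (p ∷ [])     t (cons k<p _ d) = cons k<p (tailed-++ [] t d)
tailed-++ (p ∷ q ∷ ps) t (cons k<p _ (cons k<q q<p d)) =
  cons q<p (tailed-++ (q ∷ ps) t (cons k<q ℕₚ.≤-refl d))

-- The component `k ≤ p` carries the induction: from `k ≤ q < p` the new head exceeds `k`, as
-- `Distinct (suc k)` demands.
tailed-split : ∀ {k p ps} → Tailed k (p ∷ ps) → ∃[ qs ] ∃[ t ]
               Distinct (suc k) (suc p) qs ×
               qs ++ List.replicate (suc t) k ≡ p ∷ ps × k ≤ p
tailed-split (repeated t refl) = [] , t , [] , refl , ℕₚ.≤-refl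
tailed-split (cons {p} q<p T) with tailed-split T
... | qs , t , d , eq , k≤q = p ∷ qs , t ,
  cons (ℕₚ.≤-<-trans k≤q q<p) ℕₚ.≤-refl (distinct-mono q<p d) ,
  cong (p ∷_) eq , ℕₚ.<⇒≤ (ℕₚ.≤-<-trans k≤q q<p)

-- All parts of a `Distinct (suc k)` list exceed `k`, so the first `k` marks where the repeated tail
-- begins.
++-replicate-injective : ∀ {k u u′} ps ps′ t t′ →
  Distinct (suc k) u ps → Distinct (suc k) u′ ps′ →
  ps ++ List.replicate (suc t) k ≡ ps′ ++ List.replicate (suc t′) k →
  t ≡ t′ × ps ≡ ps′
++-replicate-injective [] [] t t′ _ _ eq = ℕₚ.suc-injective (trans
  (sym (Listₚ.length-replicate (suc t)))
  (trans (cong List.length eq) (Listₚ.length-replicate (suc t′)))) , refl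
++-replicate-injective [] (p ∷ _) t t′ _ (cons k<p _ _) eq =
  contradiction k<p (ℕₚ.<-irrefl (Listₚ.∷-injectiveˡ eq))
++-replicate-injective (p ∷ _) [] t t′ (cons k<p _ _) _ eq =
  contradiction k<p (ℕₚ.<-irrefl (sym (Listₚ.∷-injectiveˡ eq)))
++-replicate-injective (p ∷ ps) (p′ ∷ ps′) t t′ (cons _ _ d) (cons _ _ d′) eq
  with Listₚ.∷-injective eq
... | refl , eq′ with ++-replicate-injective ps ps′ t t′ d d′ eq′
... | t≡t′ , ps≡ps′ = t≡t′ , cong (p ∷_) ps≡ps′

total-replicate : ∀ t k → total (List.replicate t k) ≡ t ℕ.* k
total-replicate zero    k = refl
total-replicate (suc t) k = cong (k ℕ.+_) (total-replicate t k)

-- `x^ suc k` is the obligatory copy of the smallest part, the geometric series its `t` further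
-- copies, and the product the larger, distinct parts. The index is a successor because `1# - x^ 0`
-- has constant term 0.
gf-tailed : ∀ k → IsGF
  (x^ suc k / (1# - x^ suc k) * (∏[ i ≥ suc (suc k) ] (1# + x^ i)))
  (Tailed (suc k)) total
gf-tailed k = gf-map
  (λ ((_ , t) , ps) → ps ++ List.replicate (suc t) (suc k))
  (λ { {(_ , t) , ps} (_ , _ , d) → tailed-++ ps t d })
  (λ { {(_ , t) , ps} _ → trans (sum-++ ps _)
        (trans (ℕₚ.+-comm (total ps) _)
               (cong (ℕ._+ total ps) (total-replicate (suc t) (suc k)))) })
  (λ { {(_ , t) , ps} {(_ , t′) , ps′} ((refl , _) , _ , d) ((refl , _) , _ , d′) eq →
       let (t≡t′ , ps≡ps′) = ++-replicate-injective ps ps′ t t′ d d′ eq in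
       cong₂ (λ t ps → (tt , t) , ps) t≡t′ ps≡ps′ })
  surj
  (gf-* (gf-* (gf-x^ {ω = λ _ → suc k} tt (suc k) refl) (gf-geometric k))
        (gf-∏ (suc (suc k))))
  where
  surj : ∀ {ps} → Tailed (suc k) ps → _
  surj {_ ∷ _} T with tailed-split T
  ... | qs , t , d , eq , _ =
    ((tt , t) , qs) , ((refl , tt) , _ , d) , eq

Restricted : List ℕ → Set
Restricted ps = ps ≡ [] ⊎ ∃[ k ] Tailed (suc k) ps

private
  G : ℕ → Series
  G k = x^ k / (1# - x^ k) * (∏[ i ≥ suc k ] (1# + x^ i))

gf-partialSum : ∀ N → IsGF (partialSum (G ∘ suc) N)
  (λ ps → ∃[ k ] k < N × Tailed (suc k) ps) total
gf-partialSum zero    = gf-empty λ ()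
gf-partialSum (suc N) = gf-equiv
  [ (λ T → N , ℕₚ.≤-refl , T) , (λ (k , k<N , T) → k , ℕₚ.m<n⇒m<1+n k<N , T) ]′
  split
  (gf-+ (λ { T (k , k<N , T′) → ℕₚ.<⇒≢ k<N (ℕₚ.suc-injective (tailed-unique T′ T)) })
        (gf-tailed N) (gf-partialSum N))
  where
  split : ∀ {ps} → ∃[ k ] k < suc N × Tailed (suc k) ps →
          Tailed (suc N) ps ⊎ ∃[ k ] k < N × Tailed (suc k) ps
  split (k , s≤s k≤N , T) with k ℕₚ.≟ N
  ... | yes refl = inj₁ T
  ... | no  k≢N  = inj₂ (k , ℕₚ.≤∧≢⇒< k≤N k≢N , T)

-- Ensures that truncating the infinite sum after `suc n` summands loses no partition of `n`.
tailed-≤ : ∀ {k ps} → Tailed k ps → k ≤ total ps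
tailed-≤ {k} (repeated t {ps} _) = ℕₚ.m≤m+n k (total ps)
tailed-≤ (cons {p} _ T) = ℕₚ.≤-trans (tailed-≤ T) (ℕₚ.m≤n+m _ p)

gf-restricted : IsGF
  (1# + (∑[ k ≥ 1 ] (x^ k / (1# - x^ k) * (∏[ i ≥ suc k ] (1# + x^ i)))))
  Restricted total
gf-restricted = gf-+ (λ { refl (_ , ()) }) (gf-x^ [] 0 refl) (gf λ n → equiv-counts
  (λ ((k , _ , T) , eq) → (k , T) , eq)
  (λ { ((k , T) , refl) → (k , ℕₚ.m≤n⇒m≤1+n (tailed-≤ T) , T) , refl })
  (coefficient (gf-partialSum (suc n)) n))

-- Permutations

lookup-ext : ∀ {A : Set} {u v : Vec A n} → (∀ i → lookup u i ≡ lookup v i) → u ≡ v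
lookup-ext {u = []}    {[]}    _  = refl
lookup-ext {u = _ ∷ _} {_ ∷ _} eq = cong₂ _∷_ (eq Fin.zero) (lookup-ext (eq ∘ Fin.suc))

perm-injective : {π : Word n} → IsPermutation π →
                 ∀ {i j} → lookup π i ≡ lookup π j → i ≡ j
perm-injective u = VecUniqueₚ.lookup-injective u _ _

injective-perm : (π : Word n) → (∀ {i j} → lookup π i ≡ lookup π j → i ≡ j) →
                 IsPermutation π
injective-perm π inj = subst IsPermutation (Vecₚ.tabulate∘lookup π)
  (VecUniqueₚ.tabulate⁺ inj)

-- Pigeonhole: if `a` were missed, `punchOut` would squeeze `suc n` distinct letters into `Fin n`.
perm-surjective : {π : Word n} → IsPermutation π → ∀ a → ∃[ i ] lookup π i ≡ a
perm-surjective {suc n} {π} u a with Finₚ.any? (λ i → lookup π i Finₚ.≟ a)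
... | yes found = found
... | no  a∉π   = contradiction (Finₚ.injective⇒≤ {f = f} f-injective) ℕₚ.1+n≰n
  where
  a≢ : ∀ i → a ≢ lookup π i
  a≢ i eq = a∉π (i , sym eq)

  f : Fin (suc n) → Fin n
  f i = punchOut (a≢ i)

  f-injective : ∀ {i j} → f i ≡ f j → i ≡ j
  f-injective = perm-injective u ∘ Finₚ.punchOut-injective (a≢ _) (a≢ _)

-- Inversions

counts-inv : (π : Word n) → Counts (IsInversion π) (inv π)
counts-inv {n} π = counts-filter (isInversion? π)
  (Uniqueₚ.cartesianProduct⁺ (Uniqueₚ.allFin⁺ n) (Uniqueₚ.allFin⁺ n))
  (λ {(i , j)} _ → ∈-cartesianProduct⁺ (∈-allFin i) (∈-allFin j))

inv-≥ : (π : Word n) (f : Fin m → Fin n × Fin n) →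
        (∀ i → IsInversion π (f i)) → (∀ {i j} → f i ≡ f j → i ≡ j) → m ≤ inv π
inv-≥ {m = m} π f inversion inj = counts-≤ (counts-Fin m) (counts-inv π)
  (λ i ij → f i ≡ ij) (λ {i} _ → f i , inversion i , refl)
  (λ { eq refl → inj eq })

-- Avoidance of the patterns, on vectors of letters

Avoids132 Avoids213 Avoids1324 Avoids3421 : Vec (Fin m) n → Set
Avoids132 v = ∀ {i j k} → i Fin.< j → j Fin.< k →
  lookup v i Fin.< lookup v k → lookup v k Fin.< lookup v j → ⊥
Avoids213 v = ∀ {i j k} → i Fin.< j → j Fin.< k →
  lookup v j Fin.< lookup v i → lookup v i Fin.< lookup v k → ⊥
Avoids1324 v = ∀ {i j k l} → i Fin.< j → j Fin.< k → k Fin.< l →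
  lookup v i Fin.< lookup v k → lookup v k Fin.< lookup v j →
  lookup v j Fin.< lookup v l → ⊥
Avoids3421 v = ∀ {i j k l} → i Fin.< j → j Fin.< k → k Fin.< l →
  lookup v l Fin.< lookup v k → lookup v k Fin.< lookup v i →
  lookup v i Fin.< lookup v j → ⊥

increasing₄ : {a b c d : Fin n} → a Fin.< b → b Fin.< c → c Fin.< d →
              Increasing (a ∷ b ∷ c ∷ d ∷ [])
increasing₄ {a = a} {b} {c} {d} a<b b<c c<d = go
  where
  a<c = ℕₚ.<-trans a<b b<c
  b<d = ℕₚ.<-trans b<c c<d

  go : Increasing (a ∷ b ∷ c ∷ d ∷ [])
  go Fin.zero (Fin.suc Fin.zero) _ = a<b
  go Fin.zero (Fin.suc (Fin.suc Fin.zero)) _ = a<c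
  go Fin.zero (Fin.suc (Fin.suc (Fin.suc Fin.zero))) _ = ℕₚ.<-trans a<c c<d
  go (Fin.suc Fin.zero) (Fin.suc (Fin.suc Fin.zero)) _ = b<c
  go (Fin.suc Fin.zero) (Fin.suc (Fin.suc (Fin.suc Fin.zero))) _ = b<d
  go (Fin.suc (Fin.suc Fin.zero)) (Fin.suc (Fin.suc (Fin.suc Fin.zero))) _ = c<d
  go Fin.zero Fin.zero ()
  go (Fin.suc Fin.zero) (Fin.suc Fin.zero) (s≤s ())
  go (Fin.suc (Fin.suc Fin.zero)) (Fin.suc Fin.zero) (s≤s ())
  go (Fin.suc (Fin.suc (Fin.suc Fin.zero))) (Fin.suc Fin.zero) (s≤s ())
  go (Fin.suc (Fin.suc Fin.zero)) (Fin.suc (Fin.suc Fin.zero)) (s≤s (s≤s ()))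
  go (Fin.suc (Fin.suc (Fin.suc Fin.zero))) (Fin.suc (Fin.suc Fin.zero)) (s≤s (s≤s ()))
  go (Fin.suc (Fin.suc (Fin.suc Fin.zero))) (Fin.suc (Fin.suc (Fin.suc Fin.zero))) (s≤s (s≤s (s≤s ())))

-- Here s lists the letters of u in increasing order.
order-isomorphic : (u : Vec (Fin m) p) (q : Word p) (s : Vec (Fin m) p) →
                   Increasing s → (∀ i → lookup u i ≡ lookup s (lookup q i)) →
                   OrderIsomorphic u q
order-isomorphic u q s inc eq i j = record
  { to        = to
  ; from      = λ q< → subst₂ Fin._<_ (sym (eq i)) (sym (eq j)) (inc _ _ q<)
  ; to-cong   = λ { refl → refl }
  ; from-cong = λ { refl → refl }
  }
  where
  to : lookup u i Fin.< lookup u j → lookup q i Fin.< lookup q j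
  to u< with Finₚ.<-cmp (lookup q i) (lookup q j)
  ... | tri< q< _ _ = q<
  ... | tri≈ _ q≡ _ = contradiction u<
    (ℕₚ.<-irrefl (cong toℕ (trans (eq i) (trans (cong (lookup s) q≡) (sym (eq j))))))
  ... | tri> _ _ q> = contradiction u<
    (ℕₚ.<⇒≯ (subst₂ Fin._<_ (sym (eq j)) (sym (eq i)) (inc _ _ q>)))

module _ (π : Word n) where

  avoids-p1324 : Avoids1324 π → Avoids π p1324
  avoids-p1324 av ((i ∷ j ∷ k ∷ l ∷ []) , inc , iso) = av
    (inc (# 0) (# 1) (s≤s z≤n)) (inc (# 1) (# 2) (s≤s (s≤s z≤n)))
    (inc (# 2) (# 3) (s≤s (s≤s (s≤s z≤n))))
    (from (iso (# 0) (# 2)) (s≤s z≤n)) (from (iso (# 2) (# 1)) (s≤s (s≤s z≤n)))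
    (from (iso (# 1) (# 3)) (s≤s (s≤s (s≤s z≤n))))

  avoids-p1324⁻ : Avoids π p1324 → Avoids1324 π
  avoids-p1324⁻ av {i} {j} {k} {l} i<j j<k k<l a b c = av
    ((i ∷ j ∷ k ∷ l ∷ []) , increasing₄ i<j j<k k<l ,
     order-isomorphic (Vec.map (lookup π) (i ∷ j ∷ k ∷ l ∷ [])) (proj₂ p1324) (lookup π i ∷ lookup π k ∷ lookup π j ∷ lookup π l ∷ [])
       (increasing₄ a b c)
       λ { Fin.zero → refl
         ; (Fin.suc Fin.zero) → refl
         ; (Fin.suc (Fin.suc Fin.zero)) → refl
         ; (Fin.suc (Fin.suc (Fin.suc Fin.zero))) → refl })

  avoids-p3421 : Avoids3421 π → Avoids π p3421
  avoids-p3421 av ((i ∷ j ∷ k ∷ l ∷ []) , inc , iso) = av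
    (inc (# 0) (# 1) (s≤s z≤n)) (inc (# 1) (# 2) (s≤s (s≤s z≤n)))
    (inc (# 2) (# 3) (s≤s (s≤s (s≤s z≤n))))
    (from (iso (# 3) (# 2)) (s≤s z≤n)) (from (iso (# 2) (# 0)) (s≤s (s≤s z≤n)))
    (from (iso (# 0) (# 1)) (s≤s (s≤s (s≤s z≤n))))

  avoids-p3421⁻ : Avoids π p3421 → Avoids3421 π
  avoids-p3421⁻ av {i} {j} {k} {l} i<j j<k k<l a b c = av
    ((i ∷ j ∷ k ∷ l ∷ []) , increasing₄ i<j j<k k<l ,
     order-isomorphic (Vec.map (lookup π) (i ∷ j ∷ k ∷ l ∷ [])) (proj₂ p3421) (lookup π l ∷ lookup π k ∷ lookup π i ∷ lookup π j ∷ [])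
       (increasing₄ a b c)
       λ { Fin.zero → refl
         ; (Fin.suc Fin.zero) → refl
         ; (Fin.suc (Fin.suc Fin.zero)) → refl
         ; (Fin.suc (Fin.suc (Fin.suc Fin.zero))) → refl })

-- ρ is the reverse-complement of the inverse of π

record Mirror {n} (π ρ : Word n) : Set where
  constructor mirror
  field
    mirrored : ∀ i → lookup ρ (opposite (lookup π i)) ≡ opposite i

open Mirror

opposite-< : {i j : Fin n} → i Fin.< j → opposite j Fin.< opposite i
opposite-< {n} {i} {j} i<j = subst₂ _<_
  (sym (Finₚ.opposite-prop j)) (sym (Finₚ.opposite-prop i))
  (ℕₚ.∸-monoʳ-< (s≤s i<j) (Finₚ.toℕ<n j))

opposite-injective : {i j : Fin n} → opposite i ≡ opposite j → i ≡ j
opposite-injective {i = i} {j} eq = trans (sym (Finₚ.opposite-involutive i))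
  (trans (cong opposite eq) (Finₚ.opposite-involutive j))

module _ {π ρ : Word n} (perm : IsPermutation π) (M : Mirror π ρ) where

  mirror-position : ∀ j → ∃[ i ] j ≡ opposite (lookup π i)
  mirror-position j with perm-surjective perm (opposite j)
  ... | i , eq = i , trans (sym (Finₚ.opposite-involutive j)) (cong opposite (sym eq))

  -- The graph of `π` is reflected in the antidiagonal, taking the point `(i , π i)` to
  -- `(opposite (π i) , opposite i)`; this is an involution.
  mirror-sym : Mirror ρ π
  mirror-sym = mirror λ j → reflect j
    where
    reflect : ∀ j → lookup π (opposite (lookup ρ j)) ≡ opposite j
    reflect j with mirror-position j
    ... | i , refl = trans
      (cong (lookup π) (trans (cong opposite (mirrored M i)) (Finₚ.opposite-involutive i)))
      (sym (Finₚ.opposite-involutive (lookup π i)))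

  mirror-perm : IsPermutation ρ
  mirror-perm = injective-perm ρ inj
    where
    inj : ∀ {a b} → lookup ρ a ≡ lookup ρ b → a ≡ b
    inj {a} {b} eq with mirror-position a | mirror-position b
    ... | i , refl | j , refl = cong (opposite ∘ lookup π) (opposite-injective
      (trans (sym (mirrored M i)) (trans eq (mirrored M j))))

  mirror-< : ∀ {i j} → i Fin.< j →
             lookup ρ (opposite (lookup π j)) Fin.< lookup ρ (opposite (lookup π i))
  mirror-< {i} {j} i<j = subst₂ Fin._<_ (sym (mirrored M j)) (sym (mirrored M i)) (opposite-< i<j)

  -- The letters of a 213 at `i`, `j`, `k`, taken from the largest down, become positions from left
  -- to right, carrying `opposite k`, `opposite i`, `opposite j`: a 132.
  mirror-132 : Avoids132 ρ → Avoids213 π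
  mirror-132 av i<j j<k πj<πi πi<πk = av
    (opposite-< πi<πk) (opposite-< πj<πi) (mirror-< j<k) (mirror-< i<j)

  mirror-213 : Avoids213 ρ → Avoids132 π
  mirror-213 av i<j j<k πi<πk πk<πj = av
    (opposite-< πk<πj) (opposite-< πi<πk) (mirror-< j<k) (mirror-< i<j)

  -- The pattern 3421 is its own reflection: the new word reads `opposite j`, `opposite i`,
  -- `opposite k`, `opposite l`.
  mirror-3421 : Avoids3421 ρ → Avoids3421 π
  mirror-3421 av i<j j<k k<l πl<πk πk<πi πi<πj = av
    (opposite-< πi<πj) (opposite-< πk<πi) (opposite-< πl<πk)
    (mirror-< k<l) (mirror-< j<k) (mirror-< i<j)

  mirror-inv-≤ : inv π ≤ inv ρ
  mirror-inv-≤ = counts-≤ (counts-inv π) (counts-inv ρ)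
    (λ (i , j) ab → ab ≡ (opposite (lookup π i) , opposite (lookup π j)))
    (λ { (i<j , πj<πi) → _ , (opposite-< πj<πi , mirror-< i<j) , refl })
    (λ { refl eq → cong₂ _,_
      (perm-injective perm (opposite-injective (cong proj₁ eq)))
      (perm-injective perm (opposite-injective (cong proj₂ eq))) })

mirror-inv : {π ρ : Word n} → IsPermutation π → Mirror π ρ → inv π ≡ inv ρ
mirror-inv perm M = ℕₚ.≤-antisym (mirror-inv-≤ perm M)
  (mirror-inv-≤ (mirror-perm perm M) (mirror-sym perm M))

mirror-exists : (π : Word n) → IsPermutation π → ∃[ ρ ] Mirror π ρ
mirror-exists π perm = Vec.tabulate f , mirror λ i → trans
  (Vecₚ.lookup∘tabulate f (opposite (lookup π i)))
  (cong opposite (perm-injective perm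
    (trans (proj₂ (perm-surjective perm _)) (Finₚ.opposite-involutive (lookup π i)))))
  where
  f = λ j → opposite (proj₁ (perm-surjective perm (opposite j)))

mirror-functional : {π ρ ρ′ : Word n} → IsPermutation π →
                    Mirror π ρ → Mirror π ρ′ → ρ ≡ ρ′
mirror-functional {ρ = ρ} {ρ′} perm M M′ = lookup-ext eq
  where
  eq : ∀ j → lookup ρ j ≡ lookup ρ′ j
  eq j with mirror-position perm M j
  ... | i , refl = trans (mirrored M i) (sym (mirrored M′ i))

-- Inserting a first letter

punchIn-mono-< : ∀ (a : Fin (suc n)) {x y} → x Fin.< y → punchIn a x Fin.< punchIn a y
punchIn-mono-< a x<y = ℕₚ.≰⇒> (ℕₚ.<⇒≱ x<y ∘ Finₚ.punchIn-cancel-≤ a _ _)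

punchIn-cancel-< : ∀ (a : Fin (suc n)) {x y} → punchIn a x Fin.< punchIn a y → x Fin.< y
punchIn-cancel-< a a< = ℕₚ.≰⇒> (ℕₚ.<⇒≱ a< ∘ Finₚ.punchIn-mono-≤ a _ _)

punchIn-below : ∀ (a : Fin (suc n)) x → x Fin.< a → punchIn a x Fin.< a
punchIn-below (Fin.suc a) Fin.zero    _         = s≤s z≤n
punchIn-below (Fin.suc a) (Fin.suc x) (s≤s x<a) = s≤s (punchIn-below a x x<a)

punchIn-above : ∀ (a : Fin (suc n)) x → a Fin.≤ x → a Fin.< punchIn a x
punchIn-above Fin.zero    _           _         = s≤s z≤n
punchIn-above (Fin.suc a) (Fin.suc x) (s≤s a≤x) = s≤s (punchIn-above a x a≤x)

-- Conditions on the rest `u` of a word with first letter `c`, in letters before `punchIn`. By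
-- `NoDescentAbove` no 132 starts at the first letter, by `No321Above` no 3421 does;
-- `NoDescentBelow` is a stronger form of the latter, which holds along a run of equal code entries.
NoDescentAbove NoDescentBelow No321Above : ℕ → Vec (Fin m) n → Set
NoDescentAbove c u = ∀ {i j} → i Fin.< j →
  c ≤ toℕ (lookup u j) → lookup u j Fin.< lookup u i → ⊥
NoDescentBelow c u = ∀ {i j} → i Fin.< j →
  toℕ (lookup u i) < c → lookup u j Fin.< lookup u i → ⊥
No321Above c u = ∀ {i j k} → i Fin.< j → j Fin.< k →
  c ≤ toℕ (lookup u i) → toℕ (lookup u j) < c → lookup u k Fin.< lookup u j → ⊥

NoDescent : Vec (Fin m) n → Set
NoDescent u = ∀ {i j} → i Fin.< j → lookup u j Fin.< lookup u i → ⊥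

insertFirst : Fin (suc n) → Word n → Word (suc n)
insertFirst a u = a ∷ Vec.map (punchIn a) u

module Insertion (a : Fin (suc n)) (u : Word n) where

  private
    w : Word (suc n)
    w = insertFirst a u

    lookup-suc : ∀ i → lookup w (Fin.suc i) ≡ punchIn a (lookup u i)
    lookup-suc i = Vecₚ.lookup-map i (punchIn a) u

  rises⁺ : ∀ {i j} → lookup u i Fin.< lookup u j →
           lookup w (Fin.suc i) Fin.< lookup w (Fin.suc j)
  rises⁺ {i} {j} u< rewrite lookup-suc i | lookup-suc j = punchIn-mono-< a u<

  rises⁻ : ∀ {i j} → lookup w (Fin.suc i) Fin.< lookup w (Fin.suc j) →
           lookup u i Fin.< lookup u j
  rises⁻ {i} {j} w< rewrite lookup-suc i | lookup-suc j = punchIn-cancel-< a w<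

  below⁺ : ∀ {i} → lookup u i Fin.< a → lookup w (Fin.suc i) Fin.< a
  below⁺ {i} u< rewrite lookup-suc i = punchIn-below a _ u<

  above⁺ : ∀ {i} → a Fin.≤ lookup u i → a Fin.< lookup w (Fin.suc i)
  above⁺ {i} a≤ rewrite lookup-suc i = punchIn-above a _ a≤

  below⁻ : ∀ {i} → lookup w (Fin.suc i) Fin.< a → lookup u i Fin.< a
  below⁻ w< = ℕₚ.≰⇒> (ℕₚ.<⇒≯ w< ∘ above⁺)

  above⁻ : ∀ {i} → a Fin.≤ lookup w (Fin.suc i) → a Fin.≤ lookup u i
  above⁻ a≤ = ℕₚ.≮⇒≥ (ℕₚ.≤⇒≯ a≤ ∘ below⁺)

  insert-perm : IsPermutation u → IsPermutation w
  insert-perm perm = injective-perm w inj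
    where
    inj : ∀ {i j} → lookup w i ≡ lookup w j → i ≡ j
    inj {Fin.zero}  {Fin.zero}  _  = refl
    inj {Fin.zero}  {Fin.suc j} eq =
      contradiction (sym (trans eq (lookup-suc j))) (Finₚ.punchInᵢ≢i a _)
    inj {Fin.suc i} {Fin.zero}  eq =
      contradiction (trans (sym (lookup-suc i)) eq) (Finₚ.punchInᵢ≢i a _)
    inj {Fin.suc i} {Fin.suc j} eq = cong Fin.suc (perm-injective perm
      (Finₚ.punchIn-injective a _ _
        (trans (sym (lookup-suc i)) (trans eq (lookup-suc j)))))

  insert-perm⁻ : IsPermutation w → IsPermutation u
  insert-perm⁻ perm = injective-perm u λ {i} {j} eq → Finₚ.suc-injective
    (perm-injective perm
      (trans (lookup-suc i) (trans (cong (punchIn a) eq) (sym (lookup-suc j)))))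

  -- The first letter is inverted with exactly the letters below it, one for each value below `a`
  -- because `u` is a permutation. So `toℕ a` is the first entry of the Lehmer code.
  insert-inv : IsPermutation u → inv w ≡ toℕ a ℕ.+ inv u
  insert-inv perm = counts-≡ (counts-inv w)
    (counts-⊎ (counts-Fin (toℕ a)) (counts-inv u)) R
    tot tot′
    (λ { {b = inj₁ _} (refl , j , refl , eq) (refl , j′ , refl , eq′) →
           cong (λ j → Fin.zero , Fin.suc j) (perm-injective perm
             (Finₚ.toℕ-injective (trans eq (sym eq′))))
       ; {b = inj₂ _} refl refl → refl })
    (λ { {b = inj₁ _} {inj₁ _} (refl , j , refl , eq) (_ , _ , refl , eq′) →
           cong inj₁ (Finₚ.toℕ-injective (trans (sym eq) eq′))
       ; {b = inj₁ _} {inj₂ _} (refl , _) ()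
       ; {b = inj₂ _} {inj₁ _} refl (() , _)
       ; {b = inj₂ _} {inj₂ _} refl refl → refl })
    where
    R : Fin (suc n) × Fin (suc n) → Fin (toℕ a) ⊎ (Fin n × Fin n) → Set
    R (i , j) (inj₁ x) =
      i ≡ Fin.zero × ∃[ j′ ] j ≡ Fin.suc j′ × toℕ (lookup u j′) ≡ toℕ x
    R ij (inj₂ (i , j)) = ij ≡ (Fin.suc i , Fin.suc j)

    tot : ∀ {ij} → IsInversion w ij →
          ∃[ x ] [ (λ _ → ⊤) , IsInversion u ]′ x × R ij x
    tot {Fin.zero , Fin.suc j} (_ , w<) =
      inj₁ (Fin.fromℕ< (below⁻ w<)) , tt , refl , j , refl ,
      sym (Finₚ.toℕ-fromℕ< (below⁻ w<))
    tot {Fin.suc i , Fin.suc j} (s≤s i<j , w<) =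
      inj₂ (i , j) , (i<j , rises⁻ w<) , refl

    tot′ : ∀ {x} → [ (λ _ → ⊤) , IsInversion u ]′ x →
           ∃[ ij ] IsInversion w ij × R ij x
    tot′ {inj₁ x} _ = (Fin.zero , Fin.suc j) ,
      (s≤s z≤n , below⁺ (subst (_< toℕ a) (sym u-j) (Finₚ.toℕ<n x))) ,
      refl , j , refl , u-j
      where
      x<n : toℕ x < n
      x<n = ℕₚ.<-≤-trans (Finₚ.toℕ<n x) (Finₚ.toℕ≤pred[n] a)

      preimage = perm-surjective perm (Fin.fromℕ< x<n)

      j = proj₁ preimage

      u-j : toℕ (lookup u j) ≡ toℕ x
      u-j = trans (cong toℕ (proj₂ preimage)) (Finₚ.toℕ-fromℕ< x<n)
    tot′ {inj₂ (i , j)} (i<j , u<) =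
      (Fin.suc i , Fin.suc j) , (s≤s i<j , rises⁺ u<) , refl

  insert-132 : Avoids132 u → NoDescentAbove (toℕ a) u → Avoids132 w
  insert-132 av nd {Fin.zero}  {Fin.suc j} {Fin.suc k} _ (s≤s j<k) a< w< =
    nd j<k (above⁻ (ℕₚ.<⇒≤ a<)) (rises⁻ w<)
  insert-132 av nd {Fin.suc i} {Fin.suc j} {Fin.suc k} (s≤s i<j) (s≤s j<k) w< w<′ =
    av i<j j<k (rises⁻ w<) (rises⁻ w<′)

  insert-132-tail : Avoids132 w → Avoids132 u
  insert-132-tail av i<j j<k u< u<′ =
    av (s≤s i<j) (s≤s j<k) (rises⁺ u<) (rises⁺ u<′)

  insert-132-head : Avoids132 w → NoDescentAbove (toℕ a) u
  insert-132-head av {i} {j} i<j a≤ u< =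
    av {Fin.zero} {Fin.suc i} {Fin.suc j} (s≤s z≤n) (s≤s i<j) (above⁺ a≤) (rises⁺ u<)

  insert-3421 : Avoids3421 u → No321Above (toℕ a) u → Avoids3421 w
  insert-3421 av nd {Fin.zero} {Fin.suc j} {Fin.suc k} {Fin.suc l}
    _ (s≤s j<k) (s≤s k<l) w< k<a a<j =
    nd j<k k<l (above⁻ (ℕₚ.<⇒≤ a<j)) (below⁻ k<a) (rises⁻ w<)
  insert-3421 av nd {Fin.suc i} {Fin.suc j} {Fin.suc k} {Fin.suc l}
    (s≤s i<j) (s≤s j<k) (s≤s k<l) w< w<′ w<″ =
    av i<j j<k k<l (rises⁻ w<) (rises⁻ w<′) (rises⁻ w<″)

  insert-3421-tail : Avoids3421 w → Avoids3421 u
  insert-3421-tail av i<j j<k k<l u< u<′ u<″ =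
    av (s≤s i<j) (s≤s j<k) (s≤s k<l) (rises⁺ u<) (rises⁺ u<′) (rises⁺ u<″)

  insert-3421-head : Avoids3421 w → No321Above (toℕ a) u
  insert-3421-head av {i} {j} {k} i<j j<k a≤i j<a u< =
    av {Fin.zero} {Fin.suc i} {Fin.suc j} {Fin.suc k}
      (s≤s z≤n) (s≤s i<j) (s≤s j<k) (rises⁺ u<) (below⁺ j<a) (above⁺ a≤i)

open Insertion

remove-first : ∀ (a : Fin (suc n)) v → IsPermutation (a ∷ v) →
               ∃[ u ] v ≡ Vec.map (punchIn a) u
remove-first a v perm = Vec.tabulate f , lookup-ext λ i → sym (trans
  (Vecₚ.lookup-map i (punchIn a) (Vec.tabulate f))
  (trans (cong (punchIn a) (Vecₚ.lookup∘tabulate f i))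
         (Finₚ.punchIn-punchOut (a≢ i))))
  where
  a≢ : ∀ i → a ≢ lookup v i
  a≢ i eq with perm-injective perm {Fin.zero} {Fin.suc i} eq
  ... | ()

  f = λ i → punchOut (a≢ i)

-- Lehmer codes, without their trailing zeros

data Coded : ∀ {n} → List ℕ → Word n → Set where
  []     : Coded [] []
  fixed  : ∀ {n} {u : Word n} {v} → v ≡ Vec.map (punchIn Fin.zero) u →
           Coded [] u → Coded [] (Fin.zero ∷ v)
  insert : ∀ {n} {u : Word n} {a v c cs} → 0 < c → toℕ a ≡ c →
           v ≡ Vec.map (punchIn a) u → Coded cs u → Coded (c ∷ cs) (a ∷ v)

coded-perm : ∀ {cs} {w : Word n} → Coded cs w → IsPermutation w
coded-perm []                  = VecAllPairs.[]
coded-perm (fixed refl C)      = insert-perm Fin.zero _ (coded-perm C)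
coded-perm (insert _ _ refl C) = insert-perm _ _ (coded-perm C)

coded-inv : ∀ {cs} {w : Word n} → Coded cs w → inv w ≡ total cs
coded-inv []                     = refl
coded-inv (fixed refl C)         =
  trans (insert-inv Fin.zero _ (coded-perm C)) (coded-inv C)
coded-inv (insert _ refl refl C) =
  trans (insert-inv _ _ (coded-perm C)) (cong (_ ℕ.+_) (coded-inv C))

coded-functional : ∀ {cs} {w w′ : Word n} → Coded cs w → Coded cs w′ → w ≡ w′
coded-functional []             []              = refl
coded-functional (fixed refl C) (fixed refl C′) =
  cong (insertFirst Fin.zero) (coded-functional C C′)
coded-functional (insert _ refl refl C) (insert _ eq refl C′)
  with Finₚ.toℕ-injective eq
... | refl = cong (insertFirst _) (coded-functional C C′)

map-punchIn-injective : ∀ (a : Fin (suc n)) {u u′ : Word n} →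
  Vec.map (punchIn a) u ≡ Vec.map (punchIn a) u′ → u ≡ u′
map-punchIn-injective a {u} {u′} eq = lookup-ext λ i →
  Finₚ.punchIn-injective a _ _ (trans (sym (Vecₚ.lookup-map i (punchIn a) u))
    (trans (cong (λ v → lookup v i) eq) (Vecₚ.lookup-map i (punchIn a) u′)))

coded-injective : ∀ {cs cs′} {w : Word n} → Coded cs w → Coded cs′ w → cs ≡ cs′
coded-injective []          []                = refl
coded-injective (fixed _ _) (fixed _ _)       = refl
coded-injective (fixed _ _) (insert () refl _ _)
coded-injective (insert () refl _ _) (fixed _ _)
coded-injective (insert _ refl eq C) (insert _ refl eq′ C′)
  with map-punchIn-injective _ (trans (sym eq) eq′)
... | refl = cong (_ ∷_) (coded-injective C C′)

coded-[] : ∀ n → ∃[ w ] Coded {n} [] w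
coded-[] zero    = [] , []
coded-[] (suc n) = _ , fixed refl (proj₂ (coded-[] n))

-- Removing a positive entry lowers the total at least as much as the length, so the remaining
-- entries still fit.
coded-exists : ∀ {n cs} → All (0 <_) cs → total cs < n → ∃[ w ] Coded {n} cs w
coded-exists {n} [] _ = coded-[] n
coded-exists {suc n} {suc c ∷ cs} (_ ∷ 0<cs) (s≤s ≤n) =
  _ , insert (s≤s z≤n) (Finₚ.toℕ-fromℕ< c<) refl (proj₂ (coded-exists 0<cs cs<))
  where
  c< : suc c < suc n
  c< = s≤s (ℕₚ.≤-trans (ℕₚ.m≤m+n (suc c) (total cs)) ≤n)

  cs< : total cs < n
  cs< = ℕₚ.≤-trans (s≤s (ℕₚ.m≤n+m (total cs) c)) ≤n

-- Codes of the permutations that avoid 132 and 3421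

coded-[]-noDescent : {w : Word n} → Coded [] w → NoDescent w
coded-[]-noDescent (fixed {u = u} refl C) {Fin.suc i} {Fin.suc j} (s≤s i<j) w< =
  coded-[]-noDescent C i<j (rises⁻ Fin.zero u w<)

zero-later : ∀ {w : Word (suc n)} → IsPermutation w → 0 < toℕ (lookup w Fin.zero) →
             ∃[ j ] lookup w (Fin.suc j) ≡ Fin.zero
zero-later perm 0< with perm-surjective perm Fin.zero
... | Fin.zero  , eq = contradiction 0< (ℕₚ.<-irrefl (sym (cong toℕ eq)))
... | Fin.suc j , eq = j , eq

-- A nonzero first letter forms a descent with the letter 0 further right.
noDescent-coded : ∀ {cs} {w : Word n} → NoDescent w → Coded cs w → cs ≡ []
noDescent-coded nd []          = refl
noDescent-coded nd (fixed _ _) = refl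
noDescent-coded nd C@(insert {a = a} 0<c refl _ _) with zero-later (coded-perm C) 0<c
... | j , eq = contradiction
  (subst (Fin._< a) (sym eq) 0<c) (nd {Fin.zero} {Fin.suc j} (s≤s z≤n))

-- The word is `k`, `k + 1`, ..., `k + t - 1` followed by the other letters in increasing order. Its
-- descents all lead from a letter at least `k` to one below `k`, which is the invariant of the
-- induction.
coded-repeated : ∀ t k {w : Word n} → Coded (List.replicate t k) w →
  Avoids132 w × Avoids3421 w × NoDescentBelow k w × NoDescentAbove k w
coded-repeated zero k C =
  (λ _ j<k _ → coded-[]-noDescent C j<k) ,
  (λ _ _ k<l w< _ _ → coded-[]-noDescent C k<l w<) ,
  (λ i<j _ → coded-[]-noDescent C i<j) ,
  (λ i<j _ → coded-[]-noDescent C i<j)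
coded-repeated (suc t) k (insert {u = u} {a} _ refl refl C)
  with coded-repeated t k C
... | av132 , av3421 , ndb , nda =
  insert-132 a u av132 nda ,
  insert-3421 a u av3421 (λ _ j<k _ u<a → ndb j<k u<a) ,
  ndb′ , nda′
  where
  ndb′ : NoDescentBelow (toℕ a) (insertFirst a u)
  ndb′ {Fin.zero}              _         a<a _  = ℕₚ.<-irrefl refl a<a
  ndb′ {Fin.suc i} {Fin.suc j} (s≤s i<j) w<a w< =
    ndb i<j (below⁻ a u w<a) (rises⁻ a u w<)

  nda′ : NoDescentAbove (toℕ a) (insertFirst a u)
  nda′ {Fin.zero}              _         a≤w w<a = ℕₚ.≤⇒≯ a≤w w<a
  nda′ {Fin.suc i} {Fin.suc j} (s≤s i<j) a≤w w<  =
    nda i<j (above⁻ a u a≤w) (rises⁻ a u w<)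

module _ {w : Word (suc n)} {c : ℕ} (first<c : toℕ (lookup w Fin.zero) < c)
         (av132 : Avoids132 w) where

  -- Such a descent would form a 132 with the first letter, which is below `c`.
  noDescentAbove-first : NoDescentAbove c w
  noDescentAbove-first {Fin.zero} _ c≤w w< =
    ℕₚ.<⇒≱ first<c (ℕₚ.≤-trans c≤w (ℕₚ.<⇒≤ w<))
  noDescentAbove-first {Fin.suc i} i<j c≤w w< =
    av132 {Fin.zero} (s≤s z≤n) i<j (ℕₚ.<-≤-trans first<c c≤w) w<

  -- A letter strictly between the first letter and c would make a 132 with
  -- the letter i, so all letters below c are below the first letter.
  no321Above-first : IsPermutation w → Avoids3421 w → No321Above c w
  no321Above-first perm av3421 {Fin.zero} _ _ c≤w _ _ = ℕₚ.<⇒≱ first<c c≤w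
  no321Above-first perm av3421 {Fin.suc i} {j} i<j j<k c≤w w<c w<
    with Finₚ.<-cmp (lookup w j) (lookup w Fin.zero)
  ... | tri< w<first _ _ =
    av3421 {Fin.zero} (s≤s z≤n) i<j j<k w< w<first (ℕₚ.<-≤-trans first<c c≤w)
  ... | tri≈ _ w≡first _ with perm-injective perm w≡first | i<j
  ...   | refl | ()
  no321Above-first perm av3421 {Fin.suc i} {j} i<j j<k c≤w w<c w<
      | tri> _ _ first<w =
    av132 {Fin.zero} (s≤s z≤n) i<j first<w (ℕₚ.<-≤-trans w<c c≤w)

coded-first : ∀ {c cs} {w : Word (suc n)} → Coded (c ∷ cs) w →
              toℕ (lookup w Fin.zero) ≡ c
coded-first (insert _ eq _ _) = eq

-- A strict drop in the code puts the first letter of the rest below the inserted one, and this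
-- alone prevents new patterns. The run of equal entries at the end is settled at once by
-- `coded-repeated`.
tailed-avoids : ∀ {k cs} {w : Word n} → Tailed k cs → Coded cs w →
                Avoids132 w × Avoids3421 w
tailed-avoids (repeated t refl) C =
  let (av132 , av3421 , _) = coded-repeated (suc t) _ C in av132 , av3421
tailed-avoids {n = suc (suc n)} (cons b<c T) (insert {u = u} {a} _ refl refl C)
  with tailed-avoids T C
... | av132 , av3421 =
  insert-132 a u av132 (noDescentAbove-first {w = u} first<a av132) ,
  insert-3421 a u av3421 (no321Above-first {w = u} first<a av132 (coded-perm C) av3421)
  where
  first<a : toℕ (lookup u Fin.zero) < toℕ a
  first<a = subst (_< toℕ a) (sym (coded-first C)) b<c
tailed-avoids {n = suc zero} (cons b<c T) (insert _ refl refl ())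

restricted-avoids : ∀ {cs} {w : Word n} → Restricted cs → Coded cs w →
                    Avoids132 w × Avoids3421 w
restricted-avoids (inj₁ refl) C =
  let (av132 , av3421 , _) = coded-repeated 0 0 C in av132 , av3421
restricted-avoids (inj₂ (_ , T)) C = tailed-avoids T C

-- A smaller second part would be a letter below the first letter that is
-- followed by the letter 0.
tailed-noDescentBelow : ∀ {k b cs} {w : Word n} → Tailed k (b ∷ cs) →
  Coded (b ∷ cs) w → NoDescentBelow b w → ∃[ t ] cs ≡ List.replicate t k × k ≡ b
tailed-noDescentBelow (repeated t eq) _ _ = t , eq , refl
tailed-noDescentBelow (cons q<b _)
  (insert {a = a} _ refl refl C@(insert {u = u} {a = d} {cs = cs} 0<q refl refl _)) nd =
  ⊥-elim (nd {Fin.suc Fin.zero} {Fin.suc (Fin.suc j)} (s≤s (s≤s z≤n))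
    (below⁺ a v {Fin.zero} q<b) (rises⁺ a v {Fin.suc j} {Fin.zero} (subst (Fin._< d) (sym (proj₂ z)) 0<q)))
  where
  v = insertFirst d u
  z = zero-later (coded-perm C) 0<q
  j = proj₁ z

restricted-coded : (w : Word n) → IsPermutation w → Avoids132 w → Avoids3421 w →
                   ∃[ cs ] Restricted cs × Coded cs w
restricted-coded [] _ _ _ = [] , inj₁ refl , []
restricted-coded (a ∷ v) perm av132 av3421 with remove-first a v perm
... | u , refl with restricted-coded u (insert-perm⁻ a u perm)
                      (insert-132-tail a u av132) (insert-3421-tail a u av3421)
... | cs , restricted , C = extend a perm av132 av3421 restricted C
  where
  extend : ∀ a → IsPermutation (insertFirst a u) → Avoids132 (insertFirst a u) →
           Avoids3421 (insertFirst a u) → Restricted cs → Coded cs u →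
           ∃[ cs′ ] Restricted cs′ × Coded cs′ (insertFirst a u)
  -- After a first letter 0, every descent in the rest would complete a 132.
  extend Fin.zero perm av132 av3421 _ C
    with noDescent-coded (λ i<j → insert-132-head Fin.zero u av132 i<j z≤n) C
  ... | refl = [] , inj₁ refl , fixed refl C
  extend (Fin.suc a) perm av132 av3421 (inj₁ refl) C =
    _ , inj₂ (_ , repeated 0 refl) , insert (s≤s z≤n) refl refl C
  extend a′@(Fin.suc a) perm av132 av3421 (inj₂ (k , T)) C =
    _ , inj₂ (k , prepend T C (insert-132-head a′ u av132)
                              (insert-3421-head a′ u av3421)) ,
    insert (s≤s z≤n) refl refl C
    where
    -- The first entry `b` of the code of `u` is also the first letter of `u`; it is compared with
    -- `c`.
    prepend : ∀ {n c k cs} {u : Word n} → Tailed k cs → Coded cs u →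
              NoDescentAbove c u → No321Above c u → Tailed k (c ∷ cs)
    prepend {c = c} {cs = b ∷ cs} {u} T C@(insert {a = d} _ refl _ _) nda n321
      with ℕₚ.<-cmp b c
    ... | tri< b<c _ _ = cons b<c T
    -- The first letter of `u` can play the 4 of a 3421, so no descent starts below `b`; then all
    -- further parts equal `b`.
    ... | tri≈ _ refl _ with tailed-noDescentBelow T C ndb
      where
      ndb : NoDescentBelow b u
      ndb {Fin.zero}  _   d<d _  = ℕₚ.<-irrefl refl d<d
      ndb {Fin.suc i} i<j u<  u> = n321 {Fin.zero} (s≤s z≤n) i<j ℕₚ.≤-refl u< u>
    ...   | t , refl , refl = repeated (suc t) refl
    -- The letter `c` occurs in `u` after the larger first letter `b`, a descent that `nda` forbids.
    prepend {c = c} {cs = b ∷ cs} {u} T C@(insert {a = d} _ refl _ _) nda n321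
        | tri> _ _ c<b with perm-surjective (coded-perm C) (Fin.fromℕ< c<n)
      where
      c<n = ℕₚ.<-trans c<b (Finₚ.toℕ<n d)
    ...   | Fin.zero  , eq = contradiction c<b
      (ℕₚ.<-irrefl (trans (sym (Finₚ.toℕ-fromℕ< _)) (sym (cong toℕ eq))))
    ...   | Fin.suc j , eq   = ⊥-elim (nda {Fin.zero} {Fin.suc j} (s≤s z≤n)
      (ℕₚ.≤-reflexive (sym value)) (subst (_< b) (sym value) c<b))
      where
      value : toℕ (lookup u (Fin.suc j)) ≡ c
      value = trans (cong toℕ eq) (Finₚ.toℕ-fromℕ< _)

tailed-positive : ∀ {k cs} → Tailed (suc k) cs → All (0 <_) cs
tailed-positive (repeated t refl) = s≤s z≤n ∷ replicate⁺ t (s≤s z≤n)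
tailed-positive (cons q<p T) = ℕₚ.≤-<-trans z≤n q<p ∷ tailed-positive T

restricted-exists : ∀ {n cs} → Restricted cs → total cs < n → ∃[ w ] Coded {n} cs w
restricted-exists (inj₁ refl)    = coded-exists []
restricted-exists (inj₂ (_ , T)) = coded-exists (tailed-positive T)

-- Direct sums

data Side (p q : ℕ) : Fin (p ℕ.+ q) → Set where
  left  : ∀ i → Side p q (i ↑ˡ q)
  right : ∀ j → Side p q (p ↑ʳ j)

side : ∀ p {q} x → Side p q x
side p {q} x = subst (Side p q) (Finₚ.join-splitAt p q x) (go (Fin.splitAt p x))
  where
  go : ∀ s → Side p q (Fin.join p q s)
  go (inj₁ i) = left i
  go (inj₂ j) = right j

module _ {p q : ℕ} where

  ↑ˡ-mono-< : ∀ {i j : Fin p} → i Fin.< j → (i ↑ˡ q) Fin.< (j ↑ˡ q)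
  ↑ˡ-mono-< {i} {j} = subst₂ _<_ (sym (Finₚ.toℕ-↑ˡ i q)) (sym (Finₚ.toℕ-↑ˡ j q))

  ↑ˡ-cancel-< : ∀ {i j : Fin p} → (i ↑ˡ q) Fin.< (j ↑ˡ q) → i Fin.< j
  ↑ˡ-cancel-< {i} {j} = subst₂ _<_ (Finₚ.toℕ-↑ˡ i q) (Finₚ.toℕ-↑ˡ j q)

  ↑ʳ-mono-< : ∀ {i j : Fin q} → i Fin.< j → (p ↑ʳ i) Fin.< (p ↑ʳ j)
  ↑ʳ-mono-< {i} {j} i<j = subst₂ _<_ (sym (Finₚ.toℕ-↑ʳ p i)) (sym (Finₚ.toℕ-↑ʳ p j))
    (ℕₚ.+-monoʳ-< p i<j)

  ↑ʳ-cancel-< : ∀ {i j : Fin q} → (p ↑ʳ i) Fin.< (p ↑ʳ j) → i Fin.< j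
  ↑ʳ-cancel-< {i} {j} i<j = ℕₚ.+-cancelˡ-< p _ _
    (subst₂ _<_ (Finₚ.toℕ-↑ʳ p i) (Finₚ.toℕ-↑ʳ p j) i<j)

  ↑ˡ<↑ʳ : ∀ (i : Fin p) (j : Fin q) → (i ↑ˡ q) Fin.< (p ↑ʳ j)
  ↑ˡ<↑ʳ i j = subst₂ _<_ (sym (Finₚ.toℕ-↑ˡ i q)) (sym (Finₚ.toℕ-↑ʳ p j))
    (ℕₚ.<-≤-trans (Finₚ.toℕ<n i) (ℕₚ.m≤m+n p (toℕ j)))

  ↑ʳ≮↑ˡ : ∀ {i : Fin p} {j : Fin q} → ¬ ((p ↑ʳ j) Fin.< (i ↑ˡ q))
  ↑ʳ≮↑ˡ {i} {j} = ℕₚ.<-asym (↑ˡ<↑ʳ i j)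

record DirectSum {p q} (π : Word (p ℕ.+ q)) (α : Word p) (β : Word q) : Set where
  constructor directSum
  field
    onˡ : ∀ i → lookup π (i ↑ˡ q) ≡ lookup α i ↑ˡ q
    onʳ : ∀ j → lookup π (p ↑ʳ j) ≡ p ↑ʳ lookup β j

open DirectSum

module _ {p q} {π : Word (p ℕ.+ q)} {α : Word p} {β : Word q} (S : DirectSum π α β) where

  sumˡ-mono : ∀ {i j} → lookup α i Fin.< lookup α j →
              lookup π (i ↑ˡ q) Fin.< lookup π (j ↑ˡ q)
  sumˡ-mono {i} {j} α< rewrite onˡ S i | onˡ S j = ↑ˡ-mono-< α<

  sumˡ-cancel : ∀ {i j} → lookup π (i ↑ˡ q) Fin.< lookup π (j ↑ˡ q) →
                lookup α i Fin.< lookup α j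
  sumˡ-cancel {i} {j} π< rewrite onˡ S i | onˡ S j = ↑ˡ-cancel-< π<

  sumʳ-mono : ∀ {i j} → lookup β i Fin.< lookup β j →
              lookup π (p ↑ʳ i) Fin.< lookup π (p ↑ʳ j)
  sumʳ-mono {i} {j} β< rewrite onʳ S i | onʳ S j = ↑ʳ-mono-< β<

  sumʳ-cancel : ∀ {i j} → lookup π (p ↑ʳ i) Fin.< lookup π (p ↑ʳ j) →
                lookup β i Fin.< lookup β j
  sumʳ-cancel {i} {j} π< rewrite onʳ S i | onʳ S j = ↑ʳ-cancel-< π<

  sum-cross : ∀ i j → lookup π (i ↑ˡ q) Fin.< lookup π (p ↑ʳ j)
  sum-cross i j rewrite onˡ S i | onʳ S j = ↑ˡ<↑ʳ (lookup α i) (lookup β j)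

  sum-cross⁻ : ∀ {i j} → ¬ (lookup π (p ↑ʳ j) Fin.< lookup π (i ↑ˡ q))
  sum-cross⁻ {i} {j} = ℕₚ.<-asym (sum-cross i j)

  sum-perm : IsPermutation α → IsPermutation β → IsPermutation π
  sum-perm permα permβ = injective-perm π λ {x} {y} → inj (side p x) (side p y)
    where
    inj : ∀ {x y} → Side p q x → Side p q y → lookup π x ≡ lookup π y → x ≡ y
    inj (left i) (left j) eq = cong (_↑ˡ q) (perm-injective permα
      (Finₚ.↑ˡ-injective q _ _ (trans (sym (onˡ S i)) (trans eq (onˡ S j)))))
    inj (left i)  (right j) eq =
      contradiction (sum-cross i j) (ℕₚ.<-irrefl (cong toℕ eq))
    inj (right j) (left i)  eq =
      contradiction (sum-cross i j) (ℕₚ.<-irrefl (cong toℕ (sym eq)))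
    inj (right i) (right j) eq = cong (p ↑ʳ_) (perm-injective permβ
      (Finₚ.↑ʳ-injective p _ _ (trans (sym (onʳ S i)) (trans eq (onʳ S j)))))

  summandˡ-perm : IsPermutation π → IsPermutation α
  summandˡ-perm perm = injective-perm α λ {i} {j} eq → Finₚ.↑ˡ-injective q _ _
    (perm-injective perm (trans (onˡ S i) (trans (cong (_↑ˡ q) eq) (sym (onˡ S j)))))

  summandʳ-perm : IsPermutation π → IsPermutation β
  summandʳ-perm perm = injective-perm β λ {i} {j} eq → Finₚ.↑ʳ-injective p _ _
    (perm-injective perm (trans (onʳ S i) (trans (cong (p ↑ʳ_) eq) (sym (onʳ S j)))))

  sum-inv : inv π ≡ inv α ℕ.+ inv β
  sum-inv = counts-≡ (counts-inv π) (counts-⊎ (counts-inv α) (counts-inv β)) R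
    tot tot′
    (λ { {b = inj₁ _} refl refl → refl ; {b = inj₂ _} refl refl → refl })
    functional
    where
    R : Fin (p ℕ.+ q) × Fin (p ℕ.+ q) → (Fin p × Fin p) ⊎ (Fin q × Fin q) → Set
    R xy (inj₁ (i , j)) = xy ≡ (i ↑ˡ q , j ↑ˡ q)
    R xy (inj₂ (i , j)) = xy ≡ (p ↑ʳ i , p ↑ʳ j)

    tot : ∀ {xy} → IsInversion π xy →
          ∃[ z ] [ IsInversion α , IsInversion β ]′ z × R xy z
    tot {x , y} = go (side p x) (side p y)
      where
      go : ∀ {x y} → Side p q x → Side p q y → IsInversion π (x , y) →
           ∃[ z ] [ IsInversion α , IsInversion β ]′ z × R (x , y) z
      go (left i)  (left j)  (i<j , π<) =
        inj₁ (i , j) , (↑ˡ-cancel-< i<j , sumˡ-cancel π<) , refl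
      go (left i)  (right j) (_ , π<)   = contradiction π< sum-cross⁻
      go (right i) (left j)  (i<j , _)  = contradiction i<j ↑ʳ≮↑ˡ
      go (right i) (right j) (i<j , π<) =
        inj₂ (i , j) , (↑ʳ-cancel-< i<j , sumʳ-cancel π<) , refl

    tot′ : ∀ {z} → [ IsInversion α , IsInversion β ]′ z →
           ∃[ xy ] IsInversion π xy × R xy z
    tot′ {inj₁ _} (i<j , α<) = _ , (↑ˡ-mono-< i<j , sumˡ-mono α<) , refl
    tot′ {inj₂ _} (i<j , β<) = _ , (↑ʳ-mono-< i<j , sumʳ-mono β<) , refl

    functional : ∀ {xy z z′} → R xy z → R xy z′ → z ≡ z′
    functional {z = inj₁ _} {inj₁ _} refl eq = cong inj₁ (cong₂ _,_
      (Finₚ.↑ˡ-injective q _ _ (cong proj₁ eq)) (Finₚ.↑ˡ-injective q _ _ (cong proj₂ eq)))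
    functional {z = inj₁ (i , _)} {inj₂ (j , _)} refl eq =
      contradiction (↑ˡ<↑ʳ i j) (ℕₚ.<-irrefl (cong (toℕ ∘ proj₁) eq))
    functional {z = inj₂ (j , _)} {inj₁ (i , _)} refl eq =
      contradiction (↑ˡ<↑ʳ i j) (ℕₚ.<-irrefl (cong (toℕ ∘ proj₁) (sym eq)))
    functional {z = inj₂ _} {inj₂ _} refl eq = cong inj₂ (cong₂ _,_
      (Finₚ.↑ʳ-injective p _ _ (cong proj₁ eq)) (Finₚ.↑ʳ-injective p _ _ (cong proj₂ eq)))

  -- The descent from 3 to 2 lies within one summand. In the left one it brings along the 1, giving
  -- a 132 in `α`; in the right one the 4, giving a 213 in `β`.
  sum-1324 : Avoids132 α → Avoids213 β → Avoids1324 π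
  sum-1324 av132 av213 {w} {x} {y} {z} = go (side p w) (side p x) (side p y) (side p z)
    where
    go : ∀ {w x y z} → Side p q w → Side p q x → Side p q y → Side p q z →
         w Fin.< x → x Fin.< y → y Fin.< z →
         lookup π w Fin.< lookup π y → lookup π y Fin.< lookup π x →
         lookup π x Fin.< lookup π z → ⊥
    go (left h) (left i) (left j) _ h<i i<j _ π< π<′ _ =
      av132 (↑ˡ-cancel-< h<i) (↑ˡ-cancel-< i<j) (sumˡ-cancel π<) (sumˡ-cancel π<′)
    go (right _) (left _) (left _) _ h<i _ _ _ _ _ = ↑ʳ≮↑ˡ h<i
    go _ (right _) (left _) _ _ i<j _ _ _ _ = ↑ʳ≮↑ˡ i<j
    go _ (left _) (right _) _ _ _ _ _ π< _ = sum-cross⁻ π<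
    go _ (right _) (right _) (left _) _ _ j<k _ _ _ = ↑ʳ≮↑ˡ j<k
    go _ (right i) (right j) (right k) _ i<j j<k _ π< π<′ =
      av213 (↑ʳ-cancel-< i<j) (↑ʳ-cancel-< j<k) (sumʳ-cancel π<) (sumʳ-cancel π<′)

  -- The pattern 3421 is sum-indecomposable, so no occurrence straddles the two summands.
  sum-3421 : Avoids3421 α → Avoids3421 β → Avoids3421 π
  sum-3421 avα avβ {w} {x} {y} {z} = go (side p w) (side p x) (side p y) (side p z)
    where
    go : ∀ {w x y z} → Side p q w → Side p q x → Side p q y → Side p q z →
         w Fin.< x → x Fin.< y → y Fin.< z →
         lookup π z Fin.< lookup π y → lookup π y Fin.< lookup π w →
         lookup π w Fin.< lookup π x → ⊥
    go (left _) (left _) (left _) (left _) h<i i<j j<k π< π<′ π<″ =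
      avα (↑ˡ-cancel-< h<i) (↑ˡ-cancel-< i<j) (↑ˡ-cancel-< j<k)
          (sumˡ-cancel π<) (sumˡ-cancel π<′) (sumˡ-cancel π<″)
    go (right _) (right _) (right _) (right _) h<i i<j j<k π< π<′ π<″ =
      avβ (↑ʳ-cancel-< h<i) (↑ʳ-cancel-< i<j) (↑ʳ-cancel-< j<k)
          (sumʳ-cancel π<) (sumʳ-cancel π<′) (sumʳ-cancel π<″)
    go (right _) (left _) _ _ h<i _ _ _ _ _ = ↑ʳ≮↑ˡ h<i
    go (left _) _ (right _) _ _ _ _ _ π< _ = sum-cross⁻ π<
    go _ (right _) (left _) _ _ i<j _ _ _ _ = ↑ʳ≮↑ˡ i<j
    go _ _ (right _) (left _) _ _ j<k _ _ _ = ↑ʳ≮↑ˡ j<k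
    go _ _ (left _) (right _) _ _ _ π< _ _ = sum-cross⁻ π<

  -- Any letter of the right summand serves as the 4; the argument in `Fin q` supplies one.
  summandˡ-132 : Fin q → Avoids1324 π → Avoids132 α
  summandˡ-132 last av {i} {j} {k} i<j j<k α< α<′ =
    av (↑ˡ-mono-< i<j) (↑ˡ-mono-< j<k) (↑ˡ<↑ʳ k last)
       (sumˡ-mono α<) (sumˡ-mono α<′) (sum-cross j last)

  summandʳ-213 : Fin p → Avoids1324 π → Avoids213 β
  summandʳ-213 first av {i} {j} {k} i<j j<k β< β<′ =
    av (↑ˡ<↑ʳ first i) (↑ʳ-mono-< i<j) (↑ʳ-mono-< j<k)
       (sum-cross first j) (sumʳ-mono β<) (sumʳ-mono β<′)

  summandˡ-3421 : Avoids3421 π → Avoids3421 α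
  summandˡ-3421 av h<i i<j j<k α< α<′ α<″ =
    av (↑ˡ-mono-< h<i) (↑ˡ-mono-< i<j) (↑ˡ-mono-< j<k)
       (sumˡ-mono α<) (sumˡ-mono α<′) (sumˡ-mono α<″)

  summandʳ-3421 : Avoids3421 π → Avoids3421 β
  summandʳ-3421 av h<i i<j j<k β< β<′ β<″ =
    av (↑ʳ-mono-< h<i) (↑ʳ-mono-< i<j) (↑ʳ-mono-< j<k)
       (sumʳ-mono β<) (sumʳ-mono β<′) (sumʳ-mono β<″)

sum-functional : ∀ {p q} {π π′ : Word (p ℕ.+ q)} {α : Word p} {β : Word q} →
                 DirectSum π α β → DirectSum π′ α β → π ≡ π′
sum-functional {p} {q} {π} {π′} S S′ = lookup-ext λ x → go (side p x)
  where
  go : ∀ {x} → Side p q x → lookup π x ≡ lookup π′ x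
  go (left i)  = trans (onˡ S i) (sym (onˡ S′ i))
  go (right j) = trans (onʳ S j) (sym (onʳ S′ j))

sum-injective : ∀ {p q} {π : Word (p ℕ.+ q)} {α α′ : Word p} {β β′ : Word q} →
                DirectSum π α β → DirectSum π α′ β′ → α ≡ α′ × β ≡ β′
sum-injective {p} {q} S S′ =
  lookup-ext (λ i → Finₚ.↑ˡ-injective q _ _ (trans (sym (onˡ S i)) (onˡ S′ i))) ,
  lookup-ext (λ j → Finₚ.↑ʳ-injective p _ _ (trans (sym (onʳ S j)) (onʳ S′ j)))

sum-exists : ∀ {p q} (α : Word p) (β : Word q) → ∃[ π ] DirectSum π α β
sum-exists {p} {q} α β = Vec.map (_↑ˡ q) α Vec.++ Vec.map (p ↑ʳ_) β , directSum
  (λ i → trans (Vecₚ.lookup-++ˡ (Vec.map (_↑ˡ q) α) (Vec.map (p ↑ʳ_) β) i)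
               (Vecₚ.lookup-map i (_↑ˡ q) α))
  (λ j → trans (Vecₚ.lookup-++ʳ (Vec.map (_↑ˡ q) α) (Vec.map (p ↑ʳ_) β) j)
               (Vecₚ.lookup-map j (p ↑ʳ_) β))

-- A position p that is in no inversion

module _ {p q} (π : Word (p ℕ.+ suc q)) (perm : IsPermutation π) where

  private
    x : Fin (p ℕ.+ suc q)
    x = p ↑ʳ Fin.zero

    before : Fin p → Fin (p ℕ.+ suc q)
    before i = i ↑ˡ suc q

    after : Fin q → Fin (p ℕ.+ suc q)
    after j = p ↑ʳ Fin.suc j

    before<x : ∀ i → before i Fin.< x
    before<x i = ↑ˡ<↑ʳ i Fin.zero

    x<after : ∀ j → x Fin.< after j
    x<after j = ↑ʳ-mono-< (s≤s z≤n)

    before-injective : ∀ {i j} → before i ≡ before j → i ≡ j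
    before-injective = Finₚ.↑ˡ-injective (suc q) _ _

    after-injective : ∀ {i j} → after i ≡ after j → i ≡ j
    after-injective = Finₚ.suc-injective ∘ Finₚ.↑ʳ-injective p _ _

    ≮⇒> : ∀ {a b} → a ≢ b → ¬ (lookup π a Fin.< lookup π b) →
          lookup π b Fin.< lookup π a
    ≮⇒> a≢b ≮ = ℕₚ.≤∧≢⇒< (ℕₚ.≮⇒≥ ≮)
      (a≢b ∘ sym ∘ perm-injective perm ∘ Finₚ.toℕ-injective)

    <⇒≢ : ∀ {a b : Fin (p ℕ.+ suc q)} → a Fin.< b → a ≢ b
    <⇒≢ a<b eq = ℕₚ.<-irrefl (cong toℕ eq) a<b

  module _ (av : Avoids1324 π) where

    -- If i is before x and π i > π x, some r after x has π r > π i. Every m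
    -- before x is then inverted with x or with i, or else m i x r is a 1324.
    inverted-before : ∀ i → lookup π x Fin.< lookup π (before i) →
                      q ≤ inv π ⊎ p ≤ inv π
    inverted-before i πx<πi
      with Finₚ.any? (λ r → lookup π (before i) Finₚ.<? lookup π (after r))
    -- Without such an `r`, the position `before i` is inverted with all `q` positions after `x`.
    ... | no none = inj₁ (inv-≥ π (λ r → before i , after r)
      (λ r → ↑ˡ<↑ʳ i (Fin.suc r) ,
             ≮⇒> (<⇒≢ (↑ˡ<↑ʳ i (Fin.suc r))) (λ π< → none (r , π<)))
      (after-injective ∘ cong proj₂))
    ... | yes (r , πi<πr) = inj₂ (inv-≥ π (λ m → f m (x<m? m))
      (λ m → inverted m (x<m? m)) (λ {m} {m′} → inj m m′ (x<m? m) (x<m? m′)))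
      where
      x<m? : ∀ m → Dec (lookup π x Fin.< lookup π (before m))
      x<m? m = lookup π x Finₚ.<? lookup π (before m)

      f : ∀ m → Dec (lookup π x Fin.< lookup π (before m)) →
          Fin (p ℕ.+ suc q) × Fin (p ℕ.+ suc q)
      f m (yes _) = before m , x
      f m (no  _) = before i , before m

      inverted : ∀ m d → IsInversion π (f m d)
      inverted m (yes πx<πm) = before<x m , πx<πm
      inverted m (no  πx≮πm) with Finₚ.<-cmp i m
      ... | tri< i<m _ _ = ↑ˡ-mono-< i<m ,
        ℕₚ.<-trans (≮⇒> (<⇒≢ (before<x m) ∘ sym) πx≮πm) πx<πi
      ... | tri≈ _ refl _ = contradiction πx<πi πx≮πm
      ... | tri> _ _ m<i = ⊥-elim (av (↑ˡ-mono-< m<i) (before<x i) (x<after r)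
        (≮⇒> (<⇒≢ (before<x m) ∘ sym) πx≮πm) πx<πi πi<πr)

      inj : ∀ m m′ d d′ → f m d ≡ f m′ d′ → m ≡ m′
      inj m m′ (yes _) (yes _) eq = before-injective (cong proj₁ eq)
      inj m m′ (yes _) (no  _) eq =
        contradiction (sym (cong proj₂ eq)) (<⇒≢ (before<x m′))
      inj m m′ (no  _) (yes _) eq =
        contradiction (cong proj₂ eq) (<⇒≢ (before<x m))
      inj m m′ (no  _) (no  _) eq = before-injective (cong proj₂ eq)

    -- Symmetric: unless `j` is inverted with everything before `x`, some `m` there has π m < π j.
    -- Every `s` after `x` is then inverted with `x` or with `j`, or else m x j s is a 1324.
    inverted-after : ∀ j → lookup π (after j) Fin.< lookup π x →
                     q ≤ inv π ⊎ p ≤ inv π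
    inverted-after j πj<πx
      with Finₚ.any? (λ m → lookup π (before m) Finₚ.<? lookup π (after j))
    ... | no none = inj₂ (inv-≥ π (λ m → before m , after j)
      (λ m → ↑ˡ<↑ʳ m (Fin.suc j) ,
             ≮⇒> (<⇒≢ (↑ˡ<↑ʳ m (Fin.suc j))) (λ π< → none (m , π<)))
      (before-injective ∘ cong proj₁))
    ... | yes (m , πm<πj) = inj₁ (inv-≥ π (λ s → f s (s<x? s))
      (λ s → inverted s (s<x? s)) (λ {s} {s′} → inj s s′ (s<x? s) (s<x? s′)))
      where
      s<x? : ∀ s → Dec (lookup π (after s) Fin.< lookup π x)
      s<x? s = lookup π (after s) Finₚ.<? lookup π x

      f : ∀ s → Dec (lookup π (after s) Fin.< lookup π x) →
          Fin (p ℕ.+ suc q) × Fin (p ℕ.+ suc q)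
      f s (yes _) = x , after s
      f s (no  _) = after s , after j

      inverted : ∀ s d → IsInversion π (f s d)
      inverted s (yes πs<πx) = x<after s , πs<πx
      inverted s (no  πs≮πx) with Finₚ.<-cmp s j
      ... | tri< s<j _ _ = ↑ʳ-mono-< (s≤s s<j) ,
        ℕₚ.<-trans πj<πx (≮⇒> (<⇒≢ (x<after s) ∘ sym) πs≮πx)
      ... | tri≈ _ refl _ = contradiction πj<πx πs≮πx
      ... | tri> _ _ j<s = ⊥-elim (av (before<x m) (x<after j) (↑ʳ-mono-< (s≤s j<s))
        πm<πj πj<πx (≮⇒> (<⇒≢ (x<after s) ∘ sym) πs≮πx))

      inj : ∀ s s′ d d′ → f s d ≡ f s′ d′ → s ≡ s′
      inj s s′ (yes _) (yes _) eq = after-injective (cong proj₂ eq)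
      inj s s′ (yes _) (no  _) eq =
        contradiction (cong proj₁ eq) (<⇒≢ (x<after s′))
      inj s s′ (no  _) (yes _) eq =
        contradiction (sym (cong proj₁ eq)) (<⇒≢ (x<after s))
      inj s s′ (no  _) (no  _) eq = after-injective (cong proj₁ eq)

    module _ (inv<p : inv π < p) (inv<q : inv π < q) where

      private
        few : ¬ (q ≤ inv π ⊎ p ≤ inv π)
        few = [ ℕₚ.<⇒≱ inv<q , ℕₚ.<⇒≱ inv<p ]′

        smaller : ∀ i → lookup π (before i) Fin.< lookup π x
        smaller i = ≮⇒> (<⇒≢ (before<x i) ∘ sym) (few ∘ inverted-before i)

        larger : ∀ j → lookup π x Fin.< lookup π (after j)
        larger j = ≮⇒> (<⇒≢ (x<after j) ∘ sym) (few ∘ inverted-after j)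

        -- Together with `πx≤p` this makes `x` a fixed point: the `p` letters before `x` are smaller
        -- than its letter, and every smaller letter stands before `x`.
        p≤πx : p ≤ toℕ (lookup π x)
        p≤πx = Finₚ.injective⇒≤ {f = λ i → Fin.fromℕ< (smaller i)} λ {i} {j} eq →
          before-injective (perm-injective perm (Finₚ.toℕ-injective
            (Finₚ.fromℕ<-injective _ _ (smaller i) (smaller j) eq)))

        earlier : ∀ {y} → Side p (suc q) y → lookup π y Fin.< lookup π x →
                  ∃[ i ] y ≡ before i
        earlier (left i)              _     = i , refl
        earlier (right Fin.zero)      πx<πx = contradiction πx<πx (ℕₚ.<-irrefl refl)
        earlier (right (Fin.suc j))   πj<πx = contradiction πj<πx (ℕₚ.<-asym (larger j))

        πx≤p : toℕ (lookup π x) ≤ p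
        πx≤p = Finₚ.injective⇒≤ {f = λ v → proj₁ (position v)} λ {v} {v′} eq →
          Finₚ.toℕ-injective (trans (sym (proj₂ (position v)))
            (trans (cong (λ i → toℕ (lookup π (before i))) eq) (proj₂ (position v′))))
          where
          position : (v : Fin (toℕ (lookup π x))) →
                     ∃[ i ] toℕ (lookup π (before i)) ≡ toℕ v
          position v with perm-surjective perm (Fin.inject v)
          ... | y , eq with earlier (side p y)
                 (subst (_< toℕ (lookup π x)) (sym (trans (cong toℕ eq) (Finₚ.toℕ-inject v)))
                   (Finₚ.toℕ<n v))
          ... | i , refl = i , trans (cong toℕ eq) (Finₚ.toℕ-inject v)

        valueˡ : ∀ {y} → Side p (suc q) y → toℕ y < p → ∃[ i ] y ≡ before i
        valueˡ (left i)  _   = i , refl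
        valueˡ (right j) y<p = contradiction
          (ℕₚ.≤-trans (ℕₚ.m≤m+n p (toℕ j)) (ℕₚ.≤-reflexive (sym (Finₚ.toℕ-↑ʳ p j))))
          (ℕₚ.<⇒≱ y<p)

        valueʳ : ∀ {y} → Side p (suc q) y → p ≤ toℕ y → ∃[ j ] y ≡ p ↑ʳ j
        valueʳ (right j) _   = j , refl
        valueʳ (left i)  p≤y = contradiction
          (ℕₚ.≤-<-trans (ℕₚ.≤-reflexive (Finₚ.toℕ-↑ˡ i (suc q))) (Finₚ.toℕ<n i))
          (ℕₚ.≤⇒≯ p≤y)

        fromˡ : ∀ i → ∃[ a ] lookup π (before i) ≡ before a
        fromˡ i = valueˡ (side p _) (ℕₚ.<-≤-trans (smaller i) πx≤p)

        fromʳ : ∀ j → ∃[ b ] lookup π (p ↑ʳ j) ≡ p ↑ʳ b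
        fromʳ Fin.zero    = valueʳ (side p _) p≤πx
        fromʳ (Fin.suc j) = valueʳ (side p _) (ℕₚ.≤-trans p≤πx (ℕₚ.<⇒≤ (larger j)))

      -- The fixed point `x` becomes the first position of the right summand, hence the lengths `p`
      -- and `suc q`.
      decompose : ∃[ α ] ∃[ β ] DirectSum π α β
      decompose = Vec.tabulate (proj₁ ∘ fromˡ) , Vec.tabulate (proj₁ ∘ fromʳ) , directSum
        (λ i → trans (proj₂ (fromˡ i))
          (cong before (sym (Vecₚ.lookup∘tabulate (proj₁ ∘ fromˡ) i))))
        (λ j → trans (proj₂ (fromʳ j))
          (cong (p ↑ʳ_) (sym (Vecₚ.lookup∘tabulate (proj₁ ∘ fromʳ) j))))

-- The bijection with pairs of partitions

-- The right summand `β` avoids 213 instead of 132, so its partition is the code of its mirror image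
-- `ρ`.
CodedBy : ∀ {p q} → Word (p ℕ.+ q) → List ℕ × List ℕ → Set
CodedBy {p} {q} π (cs , ds) = ∃[ α ] ∃[ β ] ∃[ ρ ]
  DirectSum {p} {q} π α β × Mirror ρ β × Coded cs α × Coded ds ρ

patterns : List Pattern
patterns = p1324 ∷ p3421 ∷ []

Pairs : ℕ → List ℕ × List ℕ → Set
Pairs k λμ = (Restricted ⊗ Restricted) λμ × (total ⊞ total) λμ ≡ k

module _ (k q : ℕ) (k<q : k < q) where

  private
    N : ℕ
    -- `suc k` letters before the cut position and `q > k` after it, both more than the `k`
    -- inversions.
    N = suc k ℕ.+ suc q

  counted-coded : {π : Word N} → Counted patterns k π →
                  ∃[ λμ ] Pairs k λμ × CodedBy {suc k} {suc q} π λμ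
  counted-coded {π} (perm , inv≡k , av1324 ∷ av3421 ∷ [])
    with decompose {suc k} {q} π perm (avoids-p1324⁻ π av1324)
           (s≤s (ℕₚ.≤-reflexive inv≡k)) (subst (_< q) (sym inv≡k) k<q)
  ... | α , β , S with mirror-exists β (summandʳ-perm S perm)
  ... | ρ , M
    with permα ← summandˡ-perm S perm
    with permβ ← summandʳ-perm S perm
    with permρ ← mirror-perm permβ M
    with M′ ← mirror-sym permβ M
    with restricted-coded α permα (summandˡ-132 S Fin.zero (avoids-p1324⁻ π av1324))
           (summandˡ-3421 S (avoids-p3421⁻ π av3421))
       | restricted-coded ρ permρ
           (mirror-213 permρ M′ (summandʳ-213 S Fin.zero (avoids-p1324⁻ π av1324)))
           (mirror-3421 permρ M′ (summandʳ-3421 S (avoids-p3421⁻ π av3421)))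
  ... | cs , R , C | ds , R′ , C′ = (cs , ds) , ((R , R′) , weight) ,
    α , β , ρ , S , M′ , C , C′
    where
    weight : total cs ℕ.+ total ds ≡ k
    weight = trans
      (cong₂ ℕ._+_ (sym (coded-inv C)) (trans (sym (coded-inv C′)) (mirror-inv permρ M′)))
      (trans (sym (sum-inv S)) inv≡k)

  coded-counted : ∀ {λμ} → Pairs k λμ →
                  ∃[ π ] Counted patterns k π × CodedBy {suc k} {suc q} π λμ
  coded-counted {cs , ds} ((R , R′) , eq)
    -- Both partitions have total at most `k`, which is below either length.
    with restricted-exists {suc k} R
           (s≤s (ℕₚ.≤-trans (ℕₚ.m≤m+n (total cs) (total ds)) (ℕₚ.≤-reflexive eq)))
       | restricted-exists {suc q} R′
           (s≤s (ℕₚ.≤-trans (ℕₚ.m≤n+m (total ds) (total cs))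
             (ℕₚ.≤-trans (ℕₚ.≤-reflexive eq) (ℕₚ.<⇒≤ k<q))))
  ... | α , C | ρ , C′ with mirror-exists ρ (coded-perm C′)
  ... | β , M with sum-exists α β
  ... | π , S
    with permα ← coded-perm C
    with permρ ← coded-perm C′
    with permβ ← mirror-perm permρ M
    with M′ ← mirror-sym permρ M
    with restricted-avoids R C | restricted-avoids R′ C′
  ... | av132 , av3421 | av132′ , av3421′ = π ,
    (sum-perm S permα permβ ,
     trans (sum-inv S) (trans
       (cong₂ ℕ._+_ (coded-inv C) (trans (sym (mirror-inv permρ M)) (coded-inv C′))) eq) ,
     avoids-p1324 π (sum-1324 S av132 (mirror-132 permβ M′ av132′)) ∷
     avoids-p3421 π (sum-3421 S av3421 (mirror-3421 permβ M′ av3421′)) ∷ []) ,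
    α , β , ρ , S , M , C , C′

  codedBy-injective : ∀ {π π′ : Word N} {λμ} → CodedBy {suc k} {suc q} π λμ →
                      CodedBy {suc k} {suc q} π′ λμ → π ≡ π′
  codedBy-injective (_ , _ , _ , S , M , C , D) (_ , _ , _ , S′ , M′ , C′ , D′)
    with coded-functional C C′ | coded-functional D D′
  ... | refl | refl with mirror-functional (coded-perm D) M M′
  ... | refl = sum-functional S S′

  codedBy-functional : ∀ {π : Word N} {λμ λμ′} → CodedBy {suc k} {suc q} π λμ →
                       CodedBy {suc k} {suc q} π λμ′ → λμ ≡ λμ′
  codedBy-functional (_ , _ , _ , S , M , C , D) (_ , _ , _ , S′ , M′ , C′ , D′)
    with sum-injective S S′
  ... | refl , refl with mirror-functional (mirror-perm (coded-perm D) M)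
                           (mirror-sym (coded-perm D) M) (mirror-sym (coded-perm D′) M′)
  ... | refl = cong₂ _,_ (coded-injective C C′) (coded-injective D D′)

  -- An equation instead of the index N itself, so that av is never unfolded.
  av-pairs : ∀ {m c} → N ≡ m → Counts (Pairs k) c → av m k patterns ≡ c
  av-pairs refl C = counts-≡
    (counts-filter (counted? patterns k) (allVecs-unique N N) (λ {π} _ → ∈-allVecs π)) C
    (CodedBy {suc k} {suc q}) counted-coded coded-counted
    codedBy-injective codedBy-functional

-- The limit sequence and its generating function

limit-gf : IsGF φ (Restricted ⊗ Restricted) (total ⊞ total) →
           ∃[ c ] IsLimitSequence patterns c × limitGF c ≈ φ
limit-gf F = c , limit , λ k → sym (proj₂ (proj₂ (coefficient F k)))
  where
  c : ℕ → ℕ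
  c k = proj₁ (coefficient F k)

  limit : IsLimitSequence patterns c
  -- The threshold belongs to `q = suc k`, the least value above `k`; a larger `n` is reached with
  -- `q = suc k + r`.
  limit k = suc k ℕ.+ suc (suc k) , λ n m≤n →
    let (r , eq) = ℕₚ.m≤n⇒∃[o]m+o≡n m≤n in
    av-pairs k (suc k ℕ.+ r) (s≤s (ℕₚ.m≤m+n k r))
      (trans (sym (ℕₚ.+-assoc (suc k) (suc (suc k)) r)) eq)
      (proj₁ (proj₂ (coefficient F k)))

proposition5p15 : ∃[ c ] IsLimitSequence (p1324 ∷ p3421 ∷ []) c ×
    limitGF c ≈ (1# + (∑[ k ≥ 1 ] (x^ k / (1# - x^ k) * (∏[ i ≥ suc k ] (1# + x^ i))))) ²
proposition5p15 = limit-gf (gf-* gf-restricted gf-restricted)
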